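{- Let $\rho_1,\rho_2:W_F\to\mathrm{GL}_2(\overline{\mathbb{Q}}_\ell)$ be a principal series and a special representation, respectively, such that $\rho_1(W_F),\rho_2(W_F)\subset\mathrm{GL}_2(\mathcal{O}_K)$, with associated Weil--Deligne representations $\chi_1\oplus\chi_2$ and $\chi\omega\oplus\chi$, where $\chi_1,\chi_2,\chi$ are $1$-dimensional representations of $W_F$. Suppose (as may be assumed without loss of generality) that there are upper triangular matrices $U_j=\begin{pmatrix}a_j&b_j\\0&d_j\end{pmatrix}\in\mathrm{GL}_2(K)$, $j=1,2$, such that $$\rho_1(g)=\begin{pmatrix}\chi_1(g)&\frac{b_1}{d_1}(\chi_2(g)-\chi_1(g))\\0&\chi_2(g)\end{pmatrix}\quad (g\in W_F),$$ $$\rho_2(\Phi^k\tau)=\begin{pmatrix}\chi\omega(\Phi^k\tau)&\frac{a_2}{d_2}t_\ell(\tau)\chi\omega(\Phi^k\tau)+\frac{b_2}{d_2}(\chi(\Phi^k\tau)-\chi\omega(\Phi^k\tau))\\0&\chi(\Phi^k\tau)\end{pmatrix}\quad(k\in\mathbb{Z},\tau\in I_F).$$ Suppose that $a_2/d_2\in\mathcal{O}_K^\times$. Then $\overline{\rho}_1\cong\overline{\rho}_2$ if and only if $q\equiv1\pmod{\ell}$, $\overline{\chi}=\overline{\chi}_1=\overline{\chi}_2$, and there exists $x\in\mathcal{O}_K^\times$ such that $$\frac{b_1x}{d_1}\bigl(\chi_2(\Phi^k\tau)-\chi_1(\Phi^k\tau)\bigr)\equiv\frac{a_2}{d_2}t_\ell(\tau)\chi\omega(\Phi^k\tau)+\frac{b_2}{d_2}\bigl(\chi(\Phi^k\tau)-\chi\omega(\Phi^k\tau)\bigr)\pmod{\lambda}$$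 for all $\tau\in I_F$, $k\in\mathbb{Z}$.
   Context: $p\neq\ell$ are odd primes. $F/\mathbb{Q}_p$ is a finite extension with residue field of order $q$, Weil group $W_F$ and inertia group $I_F$. $\Phi\in W_F$ is a fixed Frobenius element, and $\omega$ is the character of $W_F$ with $\omega(\Phi^k\tau)=q^{ -k}$ for $k\in\mathbb{Z}$, $\tau\in I_F$. $t_\ell:I_F\to\mathbb{Z}_\ell$ is a fixed continuous surjective homomorphism; it satisfies $t_\ell(g\tau g^{ -1})=\omega(g)t_\ell(\tau)$ for $g\in W_F,\tau\in I_F$. $K/\mathbb{Q}_\ell$ is a finite extension with ring of integers $\mathcal{O}_K$ and maximal ideal $\lambda$. A bar denotes reduction modulo $\lambda$. The Weil--Deligne representation associated with a continuous $\rho:W_F\to \mathrm{GL}_2(\overline{\mathbb{Q}}_\ell)$ is $(\rho_\Phi,N_\rho)$, where $N_\rho$ is the unique nilpotent matrix with $\rho(\tau)=\exp(t_\ell(\tau)N_\rho)$ for $\tau$ in some open subgroup of $I_F$, and $\rho_\Phi(\Phi^k\tau)=\rho(\Phi^k\tau)\exp(-t_\ell(\tau)N_\rho)$. All representations are continuous. $\rho$ is called a principal series if its Weil--Deligne representation is isomorphic to $(\chi_1\oplus\chi_2,0)$ for $1$-dimensional representations $\chi_1,\chi_2$ of $W_F$ (then $\rho=\rho_\Phi$), and a special representation if its Weil--Deligne representation is isomorphic to $\left(\chi\omega\oplus\chi,\begin{pmatrix}0&1\\0&0\end{pmatrix}\right)$ for some $1$-dimensional representation $\chi$. -}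

module Defs where

open import Algebra.Bundles
  using (RawGroup; RawMonoid; Group; Semiring; CommutativeRing)
open import Algebra.Morphism.Structures
  using (IsMonoidHomomorphism; IsGroupHomomorphism; IsRingIsomorphism)
import Algebra.Definitions.RawMonoid as RawMonoidDefs
import Algebra.Definitions.RawSemiring as RawSemiringDefs
import Algebra.Morphism.Construct.Composition as Composition
import Algebra.Morphism.Construct.Identity as Identity
import Algebra.Properties.CommutativeSemigroup as CommutativeSemigroupProperties
import Algebra.Properties.Group as GroupProperties
import Algebra.Properties.Monoid.Mult as MonoidMult
import Algebra.Properties.Ring as RingProperties
open import Data.Fin.Base using (Fin; toℕ)
open import Data.Integer.Base as ℤ using (ℤ; +_; -[1+_])
import Data.Integer.Properties as ℤ
open import Data.List.Base using (List; []; _∷_)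
open import Data.List.Relation.Unary.All using (All)
open import Data.Maybe.Base using (zipWith)
open import Data.Nat.Base as ℕ using (ℕ; zero; suc)
open import Data.Nat.Divisibility using (_∣_; _∤_)
open import Data.Nat.Primality using (Prime)
open import Data.Product.Base using (Σ; ∃; ∃-syntax; Σ-syntax; _×_; _,_; proj₁; proj₂)
open import Data.Rational.Base as ℚ using (ℚ; 0ℚ; 1ℚ; ↥_; ↧_)
import Data.Rational.Properties as ℚ
open import Data.Sum.Base using (inj₁; inj₂)
open import Data.Empty using (⊥-elim)
open import Function.Base using (_∘_)
open import Function.Bundles using (Bijection)
open import Level using (Level; _⊔_) renaming (suc to lsuc)
open import Relation.Binary.Definitions using (tri<; tri≈; tri>)
open import Relation.Binary.PropositionalEquality.Core as ≡ using (_≡_; _≢_)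
import Relation.Binary.PropositionalEquality.Properties as ≡
import Relation.Binary.Reasoning.Setoid as SetoidReasoning
open import Relation.Nullary.Construct.Add.Supremum using (_⁺; ⊤⁺; [_]; []-injective)
open import Relation.Nullary.Negation.Core using (¬_)
open import Relation.Unary using (Pred; _∈_; _⊆_)

import Relation.Binary.Construct.Add.Supremum.NonStrict as AddNonStrict
import Relation.Binary.Construct.Add.Supremum.Strict as AddStrict

private
  variable
    c e s c′ e′ s′ : Level

module IntegerPower (G : RawGroup c e) where
  open RawGroup G
  open RawMonoidDefs rawMonoid using () renaming (_×_ to _×ᴳ_)

  infixr 8 _^ℤ_
  _^ℤ_ : Carrier → ℤ → Carrier
  x ^ℤ (+ n)    = n ×ᴳ x
  x ^ℤ -[1+ n ] = (suc n ×ᴳ x) ⁻¹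

module IntegerPowerProperties (G : Group c e) where
  open Group G
  open GroupProperties G
  open IntegerPower rawGroup public
  open MonoidMult monoid using (×-congʳ) renaming (_×_ to _×ᴳ_)
  open SetoidReasoning setoid

  private
    commutes : ∀ x n → x ∙ (n ×ᴳ x) ≈ (n ×ᴳ x) ∙ x
    commutes x zero    = trans (identityʳ x) (sym (identityˡ x))
    commutes x (suc n) = trans (∙-congˡ (commutes x n)) (sym (assoc x (n ×ᴳ x) x))

    ^ℤ-suc : ∀ x k → x ^ℤ (ℤ.suc k) ≈ x ∙ x ^ℤ k
    ^ℤ-suc x (+ n)          = refl
    ^ℤ-suc x -[1+ zero ]    = begin
      ε                 ≈⟨ inverseʳ x ⟨
      x ∙ x ⁻¹          ≈⟨ ∙-congˡ (⁻¹-cong (identityʳ x)) ⟨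
      x ∙ (x ∙ ε) ⁻¹    ∎
    ^ℤ-suc x -[1+ suc n ] = begin
      y ⁻¹               ≈⟨ \\-leftDividesˡ x (y ⁻¹) ⟨
      x ∙ (x ⁻¹ ∙ y ⁻¹)  ≈⟨ ∙-congˡ (⁻¹-anti-homo-∙ y x) ⟨
      x ∙ (y ∙ x) ⁻¹     ≈⟨ ∙-congˡ (⁻¹-cong (commutes x (suc n))) ⟨
      x ∙ (x ∙ y) ⁻¹     ∎
      where
      y = suc n ×ᴳ x

    ^ℤ-homo-pos : ∀ x m k → x ^ℤ (+ m ℤ.+ k) ≈ (m ×ᴳ x) ∙ x ^ℤ k
    ^ℤ-homo-pos x zero    k rewrite ℤ.+-identityˡ k = sym (identityˡ (x ^ℤ k))
    ^ℤ-homo-pos x (suc m) k rewrite ℤ.suc-+ m k = begin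
      x ^ℤ (ℤ.suc (+ m ℤ.+ k))      ≈⟨ ^ℤ-suc x (+ m ℤ.+ k) ⟩
      x ∙ x ^ℤ (+ m ℤ.+ k)          ≈⟨ ∙-congˡ (^ℤ-homo-pos x m k) ⟩
      x ∙ ((m ×ᴳ x) ∙ x ^ℤ k)       ≈⟨ assoc x (m ×ᴳ x) (x ^ℤ k) ⟨
      x ∙ (m ×ᴳ x) ∙ x ^ℤ k         ∎

  ^ℤ-homo : ∀ x j k → x ^ℤ (j ℤ.+ k) ≈ x ^ℤ j ∙ x ^ℤ k
  ^ℤ-homo x (+ m)    k = ^ℤ-homo-pos x m k
  ^ℤ-homo x -[1+ m ] k = y≈x\\z y (x ^ℤ i) (x ^ℤ k) (begin
      y ∙ x ^ℤ i                ≈⟨ ^ℤ-homo-pos x (suc m) i ⟨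
      x ^ℤ (+ suc m ℤ.+ i)      ≡⟨ ≡.cong (x ^ℤ_) shift ⟩
      x ^ℤ k                    ∎)
    where
    y = suc m ×ᴳ x
    i = -[1+ m ] ℤ.+ k
    shift : + suc m ℤ.+ i ≡ k
    shift = ≡.trans (≡.sym (ℤ.+-assoc (+ suc m) -[1+ m ] k))
           (≡.trans (≡.cong (ℤ._+ k) (ℤ.+-inverseʳ (+ suc m))) (ℤ.+-identityˡ k))

  ^ℤ-neg : ∀ x k → x ^ℤ (ℤ.- k) ≈ (x ^ℤ k) ⁻¹
  ^ℤ-neg x k = inverseˡ-unique (x ^ℤ (ℤ.- k)) (x ^ℤ k) (begin
    x ^ℤ (ℤ.- k) ∙ x ^ℤ k   ≈⟨ ^ℤ-homo x (ℤ.- k) k ⟨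
    x ^ℤ (ℤ.- k ℤ.+ k)      ≡⟨ ≡.cong (x ^ℤ_) (ℤ.+-inverseˡ k) ⟩
    ε                       ∎)

-- The classical notion of field (no apartness relation is carried along,
-- unlike in HeytingField), with the usual convention 0⁻¹ = 0 making the
-- inverse a total function.
record Field c e : Set (lsuc (c ⊔ e)) where
  field
    commutativeRing : CommutativeRing c e
  open CommutativeRing commutativeRing public
  open RawSemiringDefs (Semiring.rawSemiring semiring) public using (_^_; sum) renaming (_×_ to _×ᴺ_)
  infix 9 _⁻¹
  field
    _⁻¹      : Carrier → Carrier
    ⁻¹-cong  : ∀ {x y} → x ≈ y → x ⁻¹ ≈ y ⁻¹
    inverseʳ : ∀ {x} → ¬ (x ≈ 0#) → x * x ⁻¹ ≈ 1#
    0⁻¹≈0    : 0# ⁻¹ ≈ 0#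
    1≉0      : ¬ (1# ≈ 0#)

  infixl 7 _/_
  _/_ : Carrier → Carrier → Carrier
  x / y = x * y ⁻¹

  fromℕ : ℕ → Carrier
  fromℕ n = n ×ᴺ 1#

  fromℤ : ℤ → Carrier
  fromℤ = IntegerPower._^ℤ_ (Group.rawGroup +-group) 1#

  fromℚ : ℚ → Carrier
  fromℚ r = fromℤ (↥ r) / fromℤ (↧ r)

  *-rawGroup : RawGroup c e
  *-rawGroup = record { _≈_ = _≈_ ; _∙_ = _*_ ; ε = 1# ; _⁻¹ = _⁻¹ }

  open IntegerPower *-rawGroup public using (_^ℤ_)

  monicEval : ∀ {n} → (Fin n → Carrier) → Carrier → Carrier
  monicEval {n} a x = x ^ n + sum (λ i → a i * x ^ toℕ i)

ℚ∞ : Set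
ℚ∞ = ℚ ⁺

open AddNonStrict ℚ._≤_ public using () renaming (_≤⁺_ to _≤∞_)
open AddStrict ℚ._<_ public using () renaming (_<⁺_ to _<∞_)

infixl 6 _+∞_
_+∞_ : ℚ∞ → ℚ∞ → ℚ∞
_+∞_ = zipWith ℚ._+_

0∞ : ℚ∞
0∞ = [ 0ℚ ]

module ≤∞ = AddNonStrict ℚ._≤_
module <∞ = AddStrict ℚ._<_

≤∞-refl : ∀ {r} → r ≤∞ r
≤∞-refl = ≤∞.≤⁺-reflexive-≡ ℚ.≤-reflexive ≡.refl

<⇒≤∞ : ∀ {r t} → r <∞ t → r ≤∞ t
<⇒≤∞ <∞.[ p ]        = ≤∞.[ ℚ.<⇒≤ p ]
<⇒≤∞ <∞.[ k ]<⊤⁺     = [ k ] ≤∞.≤⊤⁺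

<-≤-trans∞ : ∀ {r t u} → r <∞ t → t ≤∞ u → r <∞ u
<-≤-trans∞ = <∞.<⁺-transˡ ℚ.<-≤-trans

0≤-+∞ : ∀ {r t} → 0∞ ≤∞ r → 0∞ ≤∞ t → 0∞ ≤∞ (r +∞ t)
0≤-+∞ ≤∞.[ p ]        ≤∞.[ q ]        = ≤∞.[ ℚ.+-mono-≤ p q ]
0≤-+∞ {[ _ ]} {⊤⁺} _  _               = 0∞ ≤∞.≤⊤⁺
0≤-+∞ {⊤⁺}         _  _               = 0∞ ≤∞.≤⊤⁺

0<-+∞ : ∀ {r t} → 0∞ ≤∞ r → 0∞ <∞ t → 0∞ <∞ (r +∞ t)
0<-+∞ ≤∞.[ p ]        <∞.[ q ]        = <∞.[ ℚ.+-mono-≤-< p q ]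
0<-+∞ {[ _ ]} {⊤⁺} _  _               = <∞.[ 0ℚ ]<⊤⁺
0<-+∞ {⊤⁺}         _  _               = <∞.[ 0ℚ ]<⊤⁺

r+r≡r⇒r≡0 : ∀ r → r ℚ.+ r ≡ r → r ≡ 0ℚ
r+r≡r⇒r≡0 r eq = GroupProperties.identityˡ-unique ℚ.+-0-group r r eq

r+r≡0⇒r≡0 : ∀ r → r ℚ.+ r ≡ 0ℚ → r ≡ 0ℚ
r+r≡0⇒r≡0 r eq with ℚ.<-cmp r 0ℚ
... | tri< r<0 _ _ = ⊥-elim (ℚ.<-irrefl eq (ℚ.+-mono-< r<0 r<0))
... | tri≈ _ r≡0 _ = r≡0
... | tri> _ _ 0<r = ⊥-elim (ℚ.<-irrefl (≡.sym eq) (ℚ.+-mono-< 0<r 0<r))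

record ValuedField c e : Set (lsuc (c ⊔ e)) where
  field
    underlyingField : Field c e
  open Field underlyingField public
  field
    v      : Carrier → ℚ∞
    v-cong : ∀ {x y} → x ≈ y → v x ≡ v y
    v-0    : v 0# ≡ ⊤⁺
    v-∞    : ∀ {x} → v x ≡ ⊤⁺ → x ≈ 0#
    v-*    : ∀ x y → v (x * y) ≡ v x +∞ v y
    -- v (x + y) ≥ min (v x) (v y)
    v-+    : ∀ {r x y} → r ≤∞ v x → r ≤∞ v y → r ≤∞ v (x + y)

record Subfield (E : Field c e) s : Set (c ⊔ e ⊔ lsuc s) where
  open Field E
  field
    ⟨_⟩  : Pred Carrier s
    resp : ∀ {x y} → x ≈ y → x ∈ ⟨_⟩ → y ∈ ⟨_⟩
    0∈   : 0# ∈ ⟨_⟩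
    1∈   : 1# ∈ ⟨_⟩
    +∈   : ∀ {x y} → x ∈ ⟨_⟩ → y ∈ ⟨_⟩ → x + y ∈ ⟨_⟩
    *∈   : ∀ {x y} → x ∈ ⟨_⟩ → y ∈ ⟨_⟩ → x * y ∈ ⟨_⟩
    -∈   : ∀ {x} → x ∈ ⟨_⟩ → - x ∈ ⟨_⟩
    ⁻¹∈  : ∀ {x} → x ∈ ⟨_⟩ → x ⁻¹ ∈ ⟨_⟩

module ValuationProperties (V : ValuedField c e) where
  open ValuedField V
  open RingProperties ring using (-‿involutive; -1*x≈-x)

  v-1 : v 1# ≡ 0∞
  v-1 = cases (v 1#) ≡.refl
    where
    cases : ∀ w → v 1# ≡ w → v 1# ≡ 0∞
    cases ⊤⁺    eq = ⊥-elim (1≉0 (v-∞ eq))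
    cases [ r ] eq = ≡.trans eq (≡.cong [_] (r+r≡r⇒r≡0 r ([]-injective
      (≡.trans (≡.sym (≡.cong₂ _+∞_ eq eq))
      (≡.trans (≡.sym (v-* 1# 1#))
      (≡.trans (v-cong (*-identityˡ 1#)) eq))))))

  v-neg1 : v (- 1#) ≡ 0∞
  v-neg1 = cases (v (- 1#)) ≡.refl
    where
    square : v (- 1#) +∞ v (- 1#) ≡ 0∞
    square = ≡.trans (≡.sym (v-* (- 1#) (- 1#)))
      (≡.trans (v-cong (trans (-1*x≈-x (- 1#)) (-‿involutive 1#))) v-1)

    cases : ∀ w → v (- 1#) ≡ w → v (- 1#) ≡ 0∞
    cases ⊤⁺    eq with () ← ≡.trans (≡.sym (≡.cong₂ _+∞_ eq eq)) square
    cases [ r ] eq = ≡.trans eq (≡.cong [_] (r+r≡0⇒r≡0 r ([]-injective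
      (≡.trans (≡.sym (≡.cong₂ _+∞_ eq eq)) square))))

  0+∞ : ∀ r → 0∞ +∞ r ≡ r
  0+∞ [ r ] = ≡.cong [_] (ℚ.+-identityˡ r)
  0+∞ ⊤⁺    = ≡.refl

  v-neg : ∀ x → v (- x) ≡ v x
  v-neg x = ≡.trans (v-cong (sym (-1*x≈-x x)))
           (≡.trans (v-* (- 1#) x)
           (≡.trans (≡.cong (_+∞ v x) v-neg1) (0+∞ (v x))))

  0<-+ : ∀ {x y} → 0∞ <∞ v x → 0∞ <∞ v y → 0∞ <∞ v (x + y)
  0<-+ {x} {y} p q with ≤∞.≤⁺-total ℚ.≤-total (v x) (v y)
  ... | inj₁ x≤y = <-≤-trans∞ p (v-+ ≤∞-refl x≤y)
  ... | inj₂ y≤x = <-≤-trans∞ q (v-+ y≤x ≤∞-refl)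

  0<-resp : ∀ {x y} → x ≈ y → 0∞ <∞ v x → 0∞ <∞ v y
  0<-resp x≈y = ≡.subst (0∞ <∞_) (v-cong x≈y)

  0≤-resp : ∀ {x y} → x ≈ y → 0∞ ≤∞ v x → 0∞ ≤∞ v y
  0≤-resp x≈y = ≡.subst (0∞ ≤∞_) (v-cong x≈y)

  0<-0 : 0∞ <∞ v 0#
  0<-0 = ≡.subst (0∞ <∞_) (≡.sym v-0) <∞.[ 0ℚ ]<⊤⁺

-- Q is a completion of ℚ for the p-adic valuation normalised by v p = 1.
record IsPAdicCompletion (p : ℕ) (V : ValuedField c e)
    (Q : Subfield (ValuedField.underlyingField V) s) : Set (c ⊔ e ⊔ s) where
  open ValuedField V
  open Subfield Q
  field
    v-p       : v (fromℕ p) ≡ [ 1ℚ ]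
    v-coprime : ∀ {m} → p ∤ m → v (fromℕ m) ≡ 0∞
    dense     : ∀ {x} → x ∈ ⟨_⟩ → ∀ (r : ℚ) → ∃[ y ] [ r ] ≤∞ v (x - fromℚ y)
    complete  : (u : ℕ → Carrier) → (∀ n → u n ∈ ⟨_⟩) →
                (∀ (r : ℚ) → ∃[ N ] (∀ m n → N ℕ.≤ m → N ℕ.≤ n → [ r ] ≤∞ v (u m - u n))) →
                ∃[ x ] x ∈ ⟨_⟩ ×
                  (∀ (r : ℚ) → ∃[ N ] (∀ n → N ℕ.≤ n → [ r ] ≤∞ v (u n - x)))

-- ℚₚ inside an algebraic closure, the latter with the unique extension of
-- the p-adic valuation.
record AlgebraicClosureOfℚₚ (p : ℕ) c e s : Set (lsuc (c ⊔ e ⊔ s)) where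
  field
    valuedField : ValuedField c e
  open ValuedField valuedField public
  field
    ℚₚ           : Subfield underlyingField s
    isCompletion : IsPAdicCompletion p valuedField ℚₚ
    algebraic    : ∀ x → ∃[ n ] Σ[ a ∈ (Fin n → Carrier) ]
                     (∀ i → a i ∈ Subfield.⟨_⟩ ℚₚ) × monicEval a x ≈ 0#
    closed       : ∀ {n} (a : Fin (suc n) → Carrier) → ∃[ x ] monicEval a x ≈ 0#

  ℤₚ : Pred Carrier s
  ℤₚ x = x ∈ Subfield.⟨_⟩ ℚₚ × 0∞ ≤∞ v x

-- Up to isomorphism every finite extension of ℚₚ is a subfield of the given
-- algebraic closure, which then also serves as its own algebraic closure.
record FiniteExtension {p : ℕ} (C : AlgebraicClosureOfℚₚ p c e s) :
    Set (c ⊔ e ⊔ lsuc s) where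
  open AlgebraicClosureOfℚₚ C
  field
    subfield : Subfield underlyingField s
  open Subfield subfield public
  field
    ℚₚ⊆     : Subfield.⟨_⟩ ℚₚ ⊆ ⟨_⟩
    rank    : ℕ
    basis   : Fin rank → Carrier
    basis∈  : ∀ i → basis i ∈ ⟨_⟩
    spans   : ∀ {x} → x ∈ ⟨_⟩ → Σ[ a ∈ (Fin rank → Carrier) ]
                (∀ i → a i ∈ Subfield.⟨_⟩ ℚₚ) × x ≈ sum (λ i → a i * basis i)

module RingOfIntegers {p : ℕ} {C : AlgebraicClosureOfℚₚ p c e s} (L : FiniteExtension C) where
  open AlgebraicClosureOfℚₚ C
  open FiniteExtension L
  open ValuationProperties valuedField
  open RingProperties ring using (-‿+-comm; -‿involutive; x[y-z]≈xy-xz)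
  open CommutativeSemigroupProperties
    (CommutativeRing.+-commutativeSemigroup commutativeRing) using (interchange)

  𝒪 : Pred Carrier s
  𝒪 x = x ∈ ⟨_⟩ × 0∞ ≤∞ v x

  𝒪ˣ : Pred Carrier (c ⊔ e ⊔ s)
  𝒪ˣ x = x ∈ 𝒪 × ∃[ y ] y ∈ 𝒪 × x * y ≈ 1#

  𝔪 : Pred Carrier s
  𝔪 x = x ∈ ⟨_⟩ × 0∞ <∞ v x

  infix 4 _≡_mod𝔪
  _≡_mod𝔪 : Carrier → Carrier → Set s
  x ≡ y mod𝔪 = x - y ∈ 𝔪

  𝔪-resp : ∀ {x y} → x ≈ y → x ∈ 𝔪 → y ∈ 𝔪
  𝔪-resp x≈y (k , p) = resp x≈y k , 0<-resp x≈y p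

  𝔪-0 : 0# ∈ 𝔪
  𝔪-0 = 0∈ , 0<-0

  𝔪-+ : ∀ {x y} → x ∈ 𝔪 → y ∈ 𝔪 → x + y ∈ 𝔪
  𝔪-+ (k , p) (l , q) = +∈ k l , 0<-+ p q

  𝔪-neg : ∀ {x} → x ∈ 𝔪 → - x ∈ 𝔪
  𝔪-neg {x} (k , p) = -∈ k , ≡.subst (0∞ <∞_) (≡.sym (v-neg x)) p

  𝔪-* : ∀ {x y} → x ∈ 𝒪 → y ∈ 𝔪 → x * y ∈ 𝔪
  𝔪-* {x} {y} (k , p) (l , q) = *∈ k l , ≡.subst (0∞ <∞_) (≡.sym (v-* x y)) (0<-+∞ p q)

  𝒪-+ : ∀ {x y} → x ∈ 𝒪 → y ∈ 𝒪 → x + y ∈ 𝒪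
  𝒪-+ (k , p) (l , q) = +∈ k l , v-+ p q

  𝒪-neg : ∀ {x} → x ∈ 𝒪 → - x ∈ 𝒪
  𝒪-neg {x} (k , p) = -∈ k , ≡.subst (0∞ ≤∞_) (≡.sym (v-neg x)) p

  𝒪-* : ∀ {x y} → x ∈ 𝒪 → y ∈ 𝒪 → x * y ∈ 𝒪
  𝒪-* {x} {y} (k , p) (l , q) = *∈ k l , ≡.subst (0∞ ≤∞_) (≡.sym (v-* x y)) (0≤-+∞ p q)

  𝒪-0 : 0# ∈ 𝒪
  𝒪-0 = 0∈ , <⇒≤∞ 0<-0

  𝒪-1 : 1# ∈ 𝒪
  𝒪-1 = 1∈ , ≡.subst (0∞ ≤∞_) (≡.sym v-1) ≤∞-refl

  ≈⇒≡ : ∀ {x y} → x ≈ y → x ≡ y mod𝔪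
  ≈⇒≡ {x} {y} x≈y = 𝔪-resp (sym (trans (+-congʳ x≈y) (-‿inverseʳ y))) 𝔪-0

  neg-diff : ∀ x y → - (x - y) ≈ y - x
  neg-diff x y = trans (sym (-‿+-comm x (- y)))
    (trans (+-congˡ (-‿involutive y)) (+-comm (- x) y))

  telescope : ∀ x y z → (x - y) + (y - z) ≈ x - z
  telescope x y z = trans (+-assoc x (- y) (y - z))
    (+-congˡ (trans (sym (+-assoc (- y) y (- z)))
                    (trans (+-congʳ (-‿inverseˡ y)) (+-identityˡ (- z)))))

  +-diff : ∀ x y z w → (x - y) + (z - w) ≈ (x + z) - (y + w)
  +-diff x y z w = trans (interchange x (- y) z (- w)) (+-congˡ (-‿+-comm y w))

  *-diff : ∀ x y z w → z * (x - y) + y * (z - w) ≈ x * z - y * w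
  *-diff x y z w = trans
    (+-cong (trans (x[y-z]≈xy-xz z x y) (+-cong (*-comm z x) (-‿cong (*-comm z y))))
            (x[y-z]≈xy-xz y z w))
    (telescope (x * z) (y * z) (y * w))

  neg-neg-diff : ∀ x y → - (x - y) ≈ (- x) - (- y)
  neg-neg-diff x y = sym (-‿+-comm x (- y))

  -- 𝒪/𝔪, with representatives in 𝒪 compared modulo 𝔪.
  residueField : CommutativeRing (c ⊔ s) s
  residueField = record
    { Carrier = Σ Carrier 𝒪
    ; _≈_     = λ x y → proj₁ x ≡ proj₁ y mod𝔪
    ; _+_     = λ (x , p) (y , q) → x + y , 𝒪-+ p q
    ; _*_     = λ (x , p) (y , q) → x * y , 𝒪-* p q
    ; -_      = λ (x , p) → - x , 𝒪-neg p
    ; 0#      = 0# , 𝒪-0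
    ; 1#      = 1# , 𝒪-1
    ; isCommutativeRing = record
      { isRing = record
        { +-isAbelianGroup = record
          { isGroup = record
            { isMonoid = record
              { isSemigroup = record
                { isMagma = record
                  { isEquivalence = record
                    { refl  = ≈⇒≡ refl
                    ; sym   = λ {x} {y} p → 𝔪-resp (neg-diff (proj₁ x) (proj₁ y)) (𝔪-neg p)
                    ; trans = λ {x} {y} {z} p q →
                        𝔪-resp (telescope (proj₁ x) (proj₁ y) (proj₁ z)) (𝔪-+ p q)
                    }
                  ; ∙-cong = λ {x} {y} {z} {w} p q →
                      𝔪-resp (+-diff (proj₁ x) (proj₁ y) (proj₁ z) (proj₁ w)) (𝔪-+ p q)
                  }
                ; assoc = λ x y z → ≈⇒≡ (+-assoc (proj₁ x) (proj₁ y) (proj₁ z))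
                }
              ; identity = (λ x → ≈⇒≡ (+-identityˡ (proj₁ x))) , (λ x → ≈⇒≡ (+-identityʳ (proj₁ x)))
              }
            ; inverse = (λ x → ≈⇒≡ (-‿inverseˡ (proj₁ x))) , (λ x → ≈⇒≡ (-‿inverseʳ (proj₁ x)))
            ; ⁻¹-cong = λ {x} {y} p → 𝔪-resp (neg-neg-diff (proj₁ x) (proj₁ y)) (𝔪-neg p)
            }
          ; comm = λ x y → ≈⇒≡ (+-comm (proj₁ x) (proj₁ y))
          }
        ; *-cong = λ {x} {y} {z} {w} p q →
            𝔪-resp (*-diff (proj₁ x) (proj₁ y) (proj₁ z) (proj₁ w))
                   (𝔪-+ (𝔪-* (proj₂ z) p) (𝔪-* (proj₂ y) q))
        ; *-assoc = λ x y z → ≈⇒≡ (*-assoc (proj₁ x) (proj₁ y) (proj₁ z))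
        ; *-identity = (λ x → ≈⇒≡ (*-identityˡ (proj₁ x))) , (λ x → ≈⇒≡ (*-identityʳ (proj₁ x)))
        ; distrib = (λ x y z → ≈⇒≡ (distribˡ (proj₁ x) (proj₁ y) (proj₁ z)))
                  , (λ x y z → ≈⇒≡ (distribʳ (proj₁ x) (proj₁ y) (proj₁ z)))
        }
      ; *-comm = λ x y → ≈⇒≡ (*-comm (proj₁ x) (proj₁ y))
      }
    }

ResidueFieldOfOrder : {p : ℕ} {C : AlgebraicClosureOfℚₚ p c e s} →
                      FiniteExtension C → ℕ → Set (c ⊔ s)
ResidueFieldOfOrder L q =
  Bijection (≡.setoid (Fin q)) (CommutativeRing.setoid (RingOfIntegers.residueField L))

module SubgroupConstruction (G : Group c e) where
  open Group G

  subgroup : (P : Pred Carrier s) → ε ∈ P → (∀ {x y} → x ∈ P → y ∈ P → x ∙ y ∈ P) →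
             (∀ {x} → x ∈ P → x ⁻¹ ∈ P) → Group (c ⊔ s) e
  subgroup P ε∈ ∙∈ ⁻¹∈ = record
    { Carrier = Σ Carrier P
    ; _≈_     = λ g h → proj₁ g ≈ proj₁ h
    ; _∙_     = λ (g , p) (h , q) → g ∙ h , ∙∈ p q
    ; ε       = ε , ε∈
    ; _⁻¹     = λ (g , p) → g ⁻¹ , ⁻¹∈ p
    ; isGroup = record
      { isMonoid = record
        { isSemigroup = record
          { isMagma = record
            { isEquivalence = record { refl = refl ; sym = sym ; trans = trans }
            ; ∙-cong = ∙-cong
            }
          ; assoc = λ (x , _) (y , _) (z , _) → assoc x y z
          }
        ; identity = (λ (x , _) → identityˡ x) , (λ (x , _) → identityʳ x)
        }
      ; inverse = (λ (x , _) → inverseˡ x) , (λ (x , _) → inverseʳ x)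
      ; ⁻¹-cong = ⁻¹-cong
      }
    }

module GaloisGroup {p : ℕ} {C : AlgebraicClosureOfℚₚ p c e s} (F : FiniteExtension C) where
  open AlgebraicClosureOfℚₚ C
  open FiniteExtension F using (⟨_⟩)
  record Automorphism : Set (c ⊔ e ⊔ s) where
    field
      ⟦_⟧               : Carrier → Carrier
      isRingIsomorphism : IsRingIsomorphism rawRing rawRing ⟦_⟧
      fixes             : ∀ {x} → x ∈ ⟨_⟩ → ⟦ x ⟧ ≈ x
      -- Automatic mathematically, as the p-adic valuation extends uniquely.
      isometric         : ∀ x → v ⟦ x ⟧ ≡ v x
    open IsRingIsomorphism isRingIsomorphism public

  open Automorphism public using (⟦_⟧)

  private
    inverse : Automorphism → Automorphism
    inverse σ = record
      { ⟦_⟧ = from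
      ; isRingIsomorphism = record
        { isRingMonomorphism = record
          { isRingHomomorphism = record
            { isSemiringHomomorphism = record
              { isNearSemiringHomomorphism = record
                { +-isMonoidHomomorphism = record
                  { isMagmaHomomorphism = record
                    { isRelHomomorphism = record { cong = from-cong }
                    ; homo = λ x y → lift (trans (+-cong (sym (to-from x)) (sym (to-from y)))
                                                 (sym (S.+-homo (from x) (from y))))
                    }
                  ; ε-homo = lift (sym S.0#-homo)
                  }
                ; *-homo = λ x y → lift (trans (*-cong (sym (to-from x)) (sym (to-from y)))
                                               (sym (S.*-homo (from x) (from y))))
                }
              ; 1#-homo = lift (sym S.1#-homo)
              }
            ; -‿homo = λ x → lift (trans (-‿cong (sym (to-from x))) (sym (S.-‿homo (from x))))
            }
          ; injective = λ {x} {y} eq →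
              trans (sym (to-from x)) (trans (S.⟦⟧-cong eq) (to-from y))
          }
        ; surjective = λ y → S.⟦ y ⟧ , λ z≈σy →
            trans (from-cong z≈σy) (S.injective (to-from S.⟦ y ⟧))
        }
      ; fixes = λ x∈F → lift (sym (S.fixes x∈F))
      ; isometric = λ x → ≡.trans (≡.sym (S.isometric (from x))) (v-cong (to-from x))
      }
      where
      module S = Automorphism σ
      from : Carrier → Carrier
      from y = proj₁ (S.surjective y)
      to-from : ∀ y → S.⟦ from y ⟧ ≈ y
      to-from y = proj₂ (S.surjective y) refl
      lift : ∀ {y z} → y ≈ S.⟦ z ⟧ → from y ≈ z
      lift {y} eq = S.injective (trans (to-from y) eq)
      from-cong : ∀ {x y} → x ≈ y → from x ≈ from y
      from-cong {x} {y} eq = lift (trans eq (sym (to-from y)))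

  Gal : Group (c ⊔ e ⊔ s) (c ⊔ e)
  Gal = record
    { Carrier = Automorphism
    ; _≈_     = λ σ τ → ∀ x → ⟦ σ ⟧ x ≈ ⟦ τ ⟧ x
    ; _∙_     = λ σ τ → record
      { ⟦_⟧ = ⟦ σ ⟧ ∘ ⟦ τ ⟧
      ; isRingIsomorphism = Composition.isRingIsomorphism trans (rri τ) (rri σ)
      ; fixes = λ x∈F → trans (Automorphism.⟦⟧-cong σ (Automorphism.fixes τ x∈F))
                              (Automorphism.fixes σ x∈F)
      ; isometric = λ x → ≡.trans (Automorphism.isometric σ (⟦ τ ⟧ x)) (Automorphism.isometric τ x)
      }
    ; ε       = record
      { ⟦_⟧ = λ x → x
      ; isRingIsomorphism = Identity.isRingIsomorphism rawRing refl
      ; fixes = λ _ → refl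
      ; isometric = λ _ → ≡.refl
      }
    ; _⁻¹     = inverse
    ; isGroup = record
      { isMonoid = record
        { isSemigroup = record
          { isMagma = record
            { isEquivalence = record
              { refl  = λ _ → refl
              ; sym   = λ eq x → sym (eq x)
              ; trans = λ eq eq′ x → trans (eq x) (eq′ x)
              }
            ; ∙-cong = λ {σ} {σ′} {τ} {τ′} eq eq′ x →
                trans (Automorphism.⟦⟧-cong σ (eq′ x)) (eq (⟦ τ′ ⟧ x))
            }
          ; assoc = λ _ _ _ _ → refl
          }
        ; identity = (λ _ _ → refl) , (λ _ _ → refl)
        }
      ; inverse = (λ σ x → Automorphism.injective σ (proj₂ (Automorphism.surjective σ _) refl))
                , (λ σ x → proj₂ (Automorphism.surjective σ x) refl)
      ; ⁻¹-cong = λ {σ} {τ} eq x → Automorphism.injective σ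
          (trans (proj₂ (Automorphism.surjective σ x) refl)
          (trans (sym (proj₂ (Automorphism.surjective τ x) refl))
                 (sym (eq _))))
      }
    }
    where
    rri = Automorphism.isRingIsomorphism

  -- Equality in the residue field of the ring of integers { v x ≥ 0 } of
  -- the algebraic closure.
  infix 4 _≡̄_
  _≡̄_ : Carrier → Carrier → Set
  x ≡̄ y = 0∞ <∞ v (x - y)

  SameResidueAction : Automorphism → Automorphism → Set c
  SameResidueAction σ τ = ∀ x → 0∞ ≤∞ v x → ⟦ σ ⟧ x ≡̄ ⟦ τ ⟧ x

  -- A geometric Frobenius: the inverse of x ↦ x^q on the residue field. This
  -- is the normalisation for which ω(Φ) = q⁻¹ gives t(ΦτΦ⁻¹) = ω(Φ)t(τ).
  IsFrobenius : ℕ → Automorphism → Set c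
  IsFrobenius q σ = ∀ x → 0∞ ≤∞ v x → (⟦ σ ⟧ x) ^ q ≡̄ x

  module WeilGroup (Φ : Automorphism) where
    open ValuationProperties valuedField
    open Group Gal using (_∙_; ε) renaming (_⁻¹ to _⁻¹ᴳ)
    open IntegerPowerProperties Gal using (^ℤ-homo; ^ℤ-neg) renaming (_^ℤ_ to _^ᴳ_)
    open RingProperties ring using (-‿+-comm; -‿involutive)

    ≡̄-reflexive : ∀ {x y} → x ≈ y → x ≡̄ y
    ≡̄-reflexive {x} {y} x≈y = 0<-resp (sym (trans (+-congʳ x≈y) (-‿inverseʳ y))) 0<-0

    ≡̄-sym : ∀ {x y} → x ≡̄ y → y ≡̄ x
    ≡̄-sym {x} {y} p = 0<-resp
      (trans (sym (-‿+-comm x (- y))) (trans (+-congˡ (-‿involutive y)) (+-comm (- x) y)))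
      (≡.subst (0∞ <∞_) (≡.sym (v-neg (x - y))) p)

    ≡̄-trans : ∀ {x y z} → x ≡̄ y → y ≡̄ z → x ≡̄ z
    ≡̄-trans {x} {y} {z} p q = 0<-resp
      (trans (+-assoc x (- y) (y - z))
        (+-congˡ (trans (sym (+-assoc (- y) y (- z)))
                        (trans (+-congʳ (-‿inverseˡ y)) (+-identityˡ (- z))))))
      (0<-+ p q)

    𝒪-stable : ∀ σ {x} → 0∞ ≤∞ v x → 0∞ ≤∞ v (⟦ σ ⟧ x)
    𝒪-stable σ {x} = ≡.subst (0∞ ≤∞_) (≡.sym (Automorphism.isometric σ x))

    apply : ∀ σ {x y} → x ≡̄ y → ⟦ σ ⟧ x ≡̄ ⟦ σ ⟧ y
    apply σ {x} {y} p =
      0<-resp (trans (S.+-homo x (- y)) (+-congˡ (S.-‿homo y)))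
        (≡.subst (0∞ <∞_) (≡.sym (S.isometric (x - y))) p)
      where module S = Automorphism σ

    ∙-same : ∀ {σ σ′ τ τ′} → SameResidueAction σ σ′ → SameResidueAction τ τ′ →
             SameResidueAction (σ ∙ τ) (σ′ ∙ τ′)
    ∙-same {σ} {σ′} {τ} {τ′} p q x x∈𝒪 =
      ≡̄-trans (apply σ (q x x∈𝒪)) (p (⟦ τ′ ⟧ x) (𝒪-stable τ′ x∈𝒪))

    inverse-same : ∀ {σ τ} → SameResidueAction σ τ → SameResidueAction (σ ⁻¹ᴳ) (τ ⁻¹ᴳ)
    inverse-same {σ} {τ} p x x∈𝒪 =
      ≡̄-trans (≡̄-sym (≡̄-reflexive (Group.inverseˡ Gal τ (⟦ σ ⁻¹ᴳ ⟧ x))))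
      (≡̄-trans (apply (τ ⁻¹ᴳ) (≡̄-sym (p (⟦ σ ⁻¹ᴳ ⟧ x) (𝒪-stable (σ ⁻¹ᴳ) x∈𝒪))))
      (apply (τ ⁻¹ᴳ) (≡̄-reflexive (Group.inverseʳ Gal σ x))))

    same-resp : ∀ {σ τ τ′} → SameResidueAction σ τ → (∀ x → ⟦ τ ⟧ x ≈ ⟦ τ′ ⟧ x) →
                SameResidueAction σ τ′
    same-resp p eq x x∈𝒪 = ≡̄-trans (p x x∈𝒪) (≡̄-reflexive (eq x))

    Inertial : Pred Automorphism c
    Inertial σ = SameResidueAction σ ε

    -- Elements whose action on the residue field is an integer power of
    -- Frobenius; the subgroup generated by Frobenius is that generated by
    -- the action of Φ.
    Weil : Pred Automorphism c
    Weil σ = ∃[ k ] SameResidueAction σ (Φ ^ᴳ k)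

    I-group : Group (c ⊔ e ⊔ s) (c ⊔ e)
    I-group = SubgroupConstruction.subgroup Gal Inertial
      (λ _ _ → ≡̄-reflexive refl) (λ {σ} {τ} p q → ∙-same {σ} {ε} {τ} {ε} p q)
      (λ {σ} p → same-resp {σ ⁻¹ᴳ} {ε ⁻¹ᴳ} {ε} (inverse-same {σ} {ε} p)
                   (GroupProperties.ε⁻¹≈ε Gal))

    W-group : Group (c ⊔ e ⊔ s) (c ⊔ e)
    W-group = SubgroupConstruction.subgroup Gal Weil
      (+ 0 , λ _ _ → ≡̄-reflexive refl)
      (λ {σ} {τ} (j , p) (k , q) → j ℤ.+ k ,
        same-resp {σ ∙ τ} {(Φ ^ᴳ j) ∙ (Φ ^ᴳ k)} {Φ ^ᴳ (j ℤ.+ k)}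
          (∙-same {σ} {Φ ^ᴳ j} {τ} {Φ ^ᴳ k} p q)
          (λ x → sym (^ℤ-homo Φ j k x)))
      (λ {σ} (k , p) → ℤ.- k ,
        same-resp {σ ⁻¹ᴳ} {(Φ ^ᴳ k) ⁻¹ᴳ} {Φ ^ᴳ (ℤ.- k)} (inverse-same {σ} {Φ ^ᴳ k} p)
          (λ x → sym (^ℤ-neg Φ k x)))

    W = Group.Carrier W-group
    I = Group.Carrier I-group

    ι : I → W
    ι (τ , p) = τ , + 0 , p

    infix 30 Φ^_∙_
    Φ^_∙_ : ℤ → I → W
    Φ^ k ∙ τ = (Φ ^ᴳ k , k , λ _ _ → ≡̄-reflexive refl) ∙ᵂ ι τ
      where open Group W-group using () renaming (_∙_ to _∙ᵂ_)

    conj : W → I → I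
    conj (g , _) (τ , p) = g ∙ τ ∙ g ⁻¹ᴳ , λ x x∈𝒪 →
      ≡̄-trans (apply g (p (⟦ g ⁻¹ᴳ ⟧ x) (𝒪-stable (g ⁻¹ᴳ) x∈𝒪)))
              (≡̄-reflexive (Group.inverseʳ Gal g x))

    -- The subgroups { τ ∈ I_F | τ fixes xs } form a neighbourhood basis of 1
    -- both in I_F and in W_F (where I_F, with its profinite topology, is
    -- open).
    Fixes : List Carrier → Pred I (c ⊔ e)
    Fixes xs (τ , _) = All (λ x → ⟦ τ ⟧ x ≈ x) xs

record M₂ (A : Set c) : Set c where
  constructor mat
  field
    m₁₁ m₁₂ m₂₁ m₂₂ : A

Entries : {A : Set c} → Pred A s → Pred (M₂ A) s
Entries P (mat a b c d) = P a × P b × P c × P d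

module Matrices (R : CommutativeRing c e) where
  open CommutativeRing R

  infix  4 _≈ᴹ_
  infixl 6 _+ᴹ_
  infixl 7 _*ᴹ_ _•_

  _≈ᴹ_ : M₂ Carrier → M₂ Carrier → Set e
  mat a b c d ≈ᴹ mat a′ b′ c′ d′ = a ≈ a′ × b ≈ b′ × c ≈ c′ × d ≈ d′

  0ᴹ 1ᴹ : M₂ Carrier
  0ᴹ = mat 0# 0# 0# 0#
  1ᴹ = mat 1# 0# 0# 1#

  _+ᴹ_ _*ᴹ_ : M₂ Carrier → M₂ Carrier → M₂ Carrier
  mat a b c d +ᴹ mat a′ b′ c′ d′ = mat (a + a′) (b + b′) (c + c′) (d + d′)
  mat a b c d *ᴹ mat a′ b′ c′ d′ =
    mat (a * a′ + b * c′) (a * b′ + b * d′) (c * a′ + d * c′) (c * b′ + d * d′)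

  _•_ : Carrier → M₂ Carrier → M₂ Carrier
  x • mat a b c d = mat (x * a) (x * b) (x * c) (x * d)

  det : M₂ Carrier → Carrier
  det (mat a b c d) = a * d - b * c

  diag : Carrier → Carrier → M₂ Carrier
  diag a d = mat a 0# 0# d

  *ᴹ-rawMonoid : RawMonoid c e
  *ᴹ-rawMonoid = record { _≈_ = _≈ᴹ_ ; _∙_ = _*ᴹ_ ; ε = 1ᴹ }

  open RawMonoidDefs *ᴹ-rawMonoid using () renaming (_×_ to _×ᴹ_)

  Nilpotent : Pred (M₂ Carrier) e
  Nilpotent N = ∃[ n ] n ×ᴹ N ≈ᴹ 0ᴹ

  -- Only meant for nilpotent N: over a field these satisfy N² = 0, so the
  -- exponential series stops after the linear term.
  exp : M₂ Carrier → M₂ Carrier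
  exp N = 1ᴹ +ᴹ N

  InGL₂ : Pred (M₂ Carrier) (c ⊔ e)
  InGL₂ P = ∃[ P′ ] P *ᴹ P′ ≈ᴹ 1ᴹ × P′ *ᴹ P ≈ᴹ 1ᴹ

  Isomorphic : {A : Set s} → (A → M₂ Carrier) → (A → M₂ Carrier) → Set (c ⊔ e ⊔ s)
  Isomorphic ρ ρ′ = ∃[ P ] P ∈ InGL₂ × (∀ g → P *ᴹ ρ g ≈ᴹ ρ′ g *ᴹ P)

module WeilRepresentations
    {p ℓ : ℕ} {Cₚ : AlgebraicClosureOfℚₚ p c e s} (F : FiniteExtension Cₚ)
    (Φ : GaloisGroup.Automorphism F) (Cℓ : AlgebraicClosureOfℚₚ ℓ c′ e′ s′) where
  open GaloisGroup F
  open WeilGroup Φ public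
  open AlgebraicClosureOfℚₚ Cℓ
  open Matrices commutativeRing public

  Close : ℚ → Carrier → Carrier → Set
  Close r x y = [ r ] ≤∞ v (x - y)

  Closeᴹ : ℚ → M₂ Carrier → M₂ Carrier → Set
  Closeᴹ r (mat a b c d) (mat a′ b′ c′ d′) =
    Close r a a′ × Close r b b′ × Close r c c′ × Close r d d′

  ContinuousOnW : {A : Set c′} → (ℚ → A → A → Set) → (W → A) → Set (c ⊔ e ⊔ s)
  ContinuousOnW close f = ∀ g r → ∃[ xs ] (∀ τ → τ ∈ Fixes xs → close r (f (g ∙ ι τ)) (f g))
    where open Group W-group using (_∙_)

  ContinuousOnI : (I → Carrier) → Set (c ⊔ e ⊔ s)
  ContinuousOnI f = ∀ g r → ∃[ xs ] (∀ τ → τ ∈ Fixes xs → Close r (f (g ∙ τ)) (f g))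
    where open Group I-group using (_∙_)

  -- A monoid homomorphism out of a group lands in the invertible elements,
  -- i.e. in GL₁ and GL₂ respectively.
  record Character : Set (c ⊔ e ⊔ s ⊔ c′ ⊔ e′) where
    field
      ⟪_⟫        : W → Carrier
      isHom      : IsMonoidHomomorphism (Group.rawMonoid W-group)
                     (RawGroup.rawMonoid *-rawGroup) ⟪_⟫
      continuous : ContinuousOnW Close ⟪_⟫

  record Representation : Set (c ⊔ e ⊔ s ⊔ c′ ⊔ e′) where
    field
      ⟪_⟫        : W → M₂ Carrier
      isHom      : IsMonoidHomomorphism (Group.rawMonoid W-group) *ᴹ-rawMonoid ⟪_⟫
      continuous : ContinuousOnW Closeᴹ ⟪_⟫

  record IsTameCharacter (t : I → Carrier) : Set (c ⊔ e ⊔ s ⊔ c′ ⊔ e′ ⊔ s′) where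
    field
      integral   : ∀ τ → t τ ∈ ℤₚ
      isHom      : IsGroupHomomorphism (Group.rawGroup I-group) (Group.rawGroup +-group) t
      continuous : ContinuousOnI t
      surjective : ∀ {z} → z ∈ ℤₚ → ∃[ τ ] t τ ≈ z

record Setting (p ℓ : ℕ) c e s c′ e′ s′ : Set (lsuc (c ⊔ e ⊔ s ⊔ c′ ⊔ e′ ⊔ s′)) where
  field
    p-prime : Prime p
    ℓ-prime : Prime ℓ
    p-odd   : 2 ∤ p
    ℓ-odd   : 2 ∤ ℓ
    p≢ℓ     : p ≢ ℓ

    Q̄ₚ      : AlgebraicClosureOfℚₚ p c e s
    F       : FiniteExtension Q̄ₚ
    q       : ℕ
    q-order : ResidueFieldOfOrder F q
    Φ       : GaloisGroup.Automorphism F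
    Φ-frob  : GaloisGroup.IsFrobenius F q Φ

    Q̄ℓ      : AlgebraicClosureOfℚₚ ℓ c′ e′ s′
    K       : FiniteExtension Q̄ℓ

  open AlgebraicClosureOfℚₚ Q̄ℓ public
  open WeilRepresentations F Φ Q̄ℓ public
  open RingOfIntegers K public
  open Character public using () renaming (⟪_⟫ to χ⟪_⟫)
  open Representation public using () renaming (⟪_⟫ to ρ⟪_⟫)

  field
    ωᶜ      : Character
    ω-value : ∀ k τ → χ⟪ ωᶜ ⟫ (Φ^ k ∙ τ) ≈ fromℕ q ^ℤ (ℤ.- k)
    tℓ      : I → Carrier
    tℓ-tame : IsTameCharacter tℓ
    tℓ-conj : ∀ g τ → tℓ (conj g τ) ≈ χ⟪ ωᶜ ⟫ g * tℓ τ

  ω : W → Carrier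
  ω = χ⟪ ωᶜ ⟫

  module K = FiniteExtension K
  module k = Matrices residueField

  -- The Weil–Deligne representation (ρ_Φ , N_ρ) of ρ is isomorphic to
  -- (r , N′). Every open subgroup of I_F contains some { τ | τ ∈ Fixes xs },
  -- itself an open subgroup.
  record HasWeilDeligne (ρ : Representation) (r : W → M₂ Carrier) (N′ : M₂ Carrier) :
      Set (c ⊔ e ⊔ s ⊔ c′ ⊔ e′) where
    field
      N         : M₂ Carrier
      nilpotent : Nilpotent N
      unipotent : ∃[ xs ] (∀ τ → τ ∈ Fixes xs → ρ⟪ ρ ⟫ (ι τ) ≈ᴹ exp (tℓ τ • N))

    ρ-Φ : ℤ → I → M₂ Carrier
    ρ-Φ k τ = ρ⟪ ρ ⟫ (Φ^ k ∙ τ) *ᴹ exp ((- tℓ τ) • N)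

    field
      P          : M₂ Carrier
      invertible : P ∈ InGL₂
      P-ρ        : ∀ k τ → P *ᴹ ρ-Φ k τ ≈ᴹ r (Φ^ k ∙ τ) *ᴹ P
      P-N        : P *ᴹ N ≈ᴹ N′ *ᴹ P

  IsPrincipalSeries : Representation → Character → Character → Set (c ⊔ e ⊔ s ⊔ c′ ⊔ e′)
  IsPrincipalSeries ρ χ₁ χ₂ = HasWeilDeligne ρ (λ g → diag (χ⟪ χ₁ ⟫ g) (χ⟪ χ₂ ⟫ g)) 0ᴹ

  IsSpecial : Representation → Character → Set (c ⊔ e ⊔ s ⊔ c′ ⊔ e′)
  IsSpecial ρ χ =
    HasWeilDeligne ρ (λ g → diag (χ⟪ χ ⟫ g * ω g) (χ⟪ χ ⟫ g)) (mat 0# 1# 0# 0#)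

  InGL₂K : Pred (M₂ Carrier) (e′ ⊔ s′)
  InGL₂K M = Entries K.⟨_⟩ M × ¬ (det M ≈ 0#)

  InGL₂𝒪 : Pred (M₂ Carrier) (c′ ⊔ e′ ⊔ s′)
  InGL₂𝒪 M = Entries 𝒪 M × 𝒪ˣ (det M)

  Integral : Representation → Set (c ⊔ e ⊔ s ⊔ c′ ⊔ e′ ⊔ s′)
  Integral ρ = ∀ g → ρ⟪ ρ ⟫ g ∈ InGL₂𝒪

  reduction : (ρ : Representation) → Integral ρ → W → M₂ (CommutativeRing.Carrier residueField)
  reduction ρ int g with ρ⟪ ρ ⟫ g | int g
  ... | mat a b c d | (a∈ , b∈ , c∈ , d∈) , _ = mat (a , a∈) (b , b∈) (c , c∈) (d , d∈)

  infix 4 _≡ᶜ_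
  _≡ᶜ_ : Character → Character → Set (c ⊔ e ⊔ s ⊔ s′)
  χ ≡ᶜ χ′ = ∀ g → χ⟪ χ ⟫ g ≡ χ⟪ χ′ ⟫ g mod𝔪

{-# OPTIONS --safe #-}

-- An isomorphism P = (x y; z w) of the reductions satisfies P ρ̄₁ = ρ̄₂ P. At an inertial τ₁ with
-- tℓ(τ₁) = 1 the upper right entry T of ρ̄₂ is a unit, because a₂/d₂ is, and the first column of
-- P ρ̄₁ = ρ̄₂ P gives T z² = 0; hence P is upper triangular and its diagonal entries are units.
-- The entries of ρ₁ depend only on characters, so ρ₁(gτg⁻¹) = ρ₁(τ), whereas in ρ₂ conjugation
-- multiplies tℓ(τ) by ω(g). Comparing the upper right entries at τ₁ and Φ⁻¹τ₁Φ gives q ≡ 1, so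
-- that ω̄ = 1; now the diagonals give χ̄ = χ̄₁ = χ̄₂, and the upper right entries give the congruence
-- with x/w as the required unit. Conversely diag(x, 1) is an isomorphism.

module Submission where

open import Defs
open import Algebra.Bundles using (CommutativeRing; Group)
open import Algebra.Morphism.Structures using (IsMonoidHomomorphism)
import Algebra.Properties.CommutativeSemigroup as CommutativeSemigroupProperties
import Algebra.Properties.Group as GroupProperties
import Algebra.Properties.Ring as RingProperties
import Algebra.Properties.Semiring.Mult as SemiringMult
open import Data.Empty using (⊥-elim)
open import Data.Integer.Base as ℤ using (ℤ; +_; -[1+_])
open import Data.Integer.Divisibility using (_∣_)
open import Data.Nat.Base as ℕ using (ℕ; zero; suc)
open import Data.Nat.Divisibility as ℕ using (_∣?_; divides)
open import Data.Product.Base using (_×_; ∃-syntax; _,_; proj₁; proj₂)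
import Data.Rational.Base as ℚ
import Data.Rational.Properties as ℚ
open import Data.Sum.Base using (_⊎_; inj₁; inj₂)
open import Function.Bundles using (_⇔_; mk⇔; Bijection)
open import Level using (Level)
open import Relation.Binary.Definitions using (tri<; tri≈; tri>)
open import Relation.Binary.PropositionalEquality.Core as ≡ using (_≡_)
import Relation.Binary.Reasoning.Setoid as SetoidReasoning
open import Relation.Nullary.Construct.Add.Supremum using (⊤⁺; [_])
open import Relation.Nullary.Decidable.Core using (yes; no)
open import Relation.Nullary.Negation.Core using (¬_)
open import Relation.Unary using (_∈_)
open M₂

private
  variable
    c e s c′ e′ s′ : Level
    p ℓ : ℕ

-- Units of a commutative ring, carried together with an inverse.

module Units (R : CommutativeRing c e) where
  open CommutativeRing R
  open CommutativeSemigroupProperties *-commutativeSemigroup using (interchange)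
  open SetoidReasoning setoid

  Inverses : Carrier → Carrier → Set e
  Inverses u u⁻¹ = u * u⁻¹ ≈ 1#

  Inverses-sym : ∀ {u u⁻¹} → Inverses u u⁻¹ → Inverses u⁻¹ u
  Inverses-sym {u} {u⁻¹} = trans (*-comm u⁻¹ u)

  Inverses-* : ∀ {u u⁻¹ w w⁻¹} → Inverses u u⁻¹ → Inverses w w⁻¹ →
               Inverses (u * w) (u⁻¹ * w⁻¹)
  Inverses-* {u} {u⁻¹} {w} {w⁻¹} uu⁻¹≈1 ww⁻¹≈1 =
    trans (interchange u w u⁻¹ w⁻¹) (trans (*-cong uu⁻¹≈1 ww⁻¹≈1) (*-identityˡ 1#))

  unit-cancelˡ : ∀ {u u⁻¹} → Inverses u u⁻¹ → ∀ {a b} → u * a ≈ u * b → a ≈ b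
  unit-cancelˡ {u} {u⁻¹} uu⁻¹≈1 {a} {b} ua≈ub = begin
    a             ≈⟨ undo a ⟨
    u⁻¹ * (u * a) ≈⟨ *-congˡ ua≈ub ⟩
    u⁻¹ * (u * b) ≈⟨ undo b ⟩
    b             ∎
    where
    undo : ∀ t → u⁻¹ * (u * t) ≈ t
    undo t = trans (sym (*-assoc u⁻¹ u t))
             (trans (*-congʳ (Inverses-sym uu⁻¹≈1)) (*-identityˡ t))

  unit-cancelʳ : ∀ {u u⁻¹} → Inverses u u⁻¹ → ∀ {a b} → a * u ≈ b * u → a ≈ b
  unit-cancelʳ {u} uu⁻¹≈1 {a} {b} au≈bu =
    unit-cancelˡ uu⁻¹≈1 (trans (*-comm u a) (trans au≈bu (*-comm b u)))

-- Intertwining relations between upper triangular 2×2 matrices.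

module Intertwiners (R : CommutativeRing c e) where
  open CommutativeRing R
  open Matrices R
  open Units R
  open CommutativeSemigroupProperties *-commutativeSemigroup using (xy∙z≈x∙zy; x∙yz≈y∙xz; xy∙z≈y∙xz)
  open GroupProperties +-group using (∙-cancelˡ)
  open SetoidReasoning setoid

  x+y0≈x : ∀ {x y z} → z ≈ 0# → x + y * z ≈ x
  x+y0≈x {x} {y} z≈0 = trans (+-congˡ (trans (*-congˡ z≈0) (zeroʳ y))) (+-identityʳ x)

  0x+y≈y : ∀ {x y z} → z ≈ 0# → z * x + y ≈ y
  0x+y≈y {x} {y} z≈0 = trans (+-congʳ (trans (*-congʳ z≈0) (zeroˡ x))) (+-identityˡ y)

  x+0y≈x : ∀ {x y} → x + 0# * y ≈ x
  x+0y≈x {x} {y} = trans (+-congˡ (zeroˡ y)) (+-identityʳ x)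

  x0+y≈y : ∀ {x y} → x * 0# + y ≈ y
  x0+y≈y {x} {y} = trans (+-congʳ (zeroʳ x)) (+-identityˡ y)

  module _ (P M M′ : M₂ Carrier) (PM≈M′P : P *ᴹ M ≈ᴹ M′ *ᴹ P)
           (m₂₁M≈0 : m₂₁ M ≈ 0#) (m₂₁M′≈0 : m₂₁ M′ ≈ 0#) where

    -- The lower left entries give `zA≈Ez`. Multiplying the upper left relation `x A = E x + T z` by
    -- `z` and substituting, the terms `E x z` cancel and `T z z` remains.
    lower-left : m₁₁ M′ ≈ m₂₂ M′ → m₁₂ M′ * (m₂₁ P * m₂₁ P) ≈ 0#
    lower-left m₁₁≈m₂₂ = ∙-cancelˡ (E * (x * z)) (T * (z * z)) 0# (begin
      E * (x * z) + T * (z * z)         ≈⟨ +-cong (*-assoc E x z) (*-assoc T z z) ⟨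
      E * x * z + T * z * z             ≈⟨ distribʳ z (E * x) (T * z) ⟨
      (E * x + T * z) * z               ≈⟨ *-congʳ (proj₁ PM≈M′P) ⟨
      (x * m₁₁ M + m₁₂ P * m₂₁ M) * z   ≈⟨ *-congʳ (x+y0≈x m₂₁M≈0) ⟩
      x * m₁₁ M * z                     ≈⟨ xy∙z≈x∙zy x (m₁₁ M) z ⟩
      x * (z * m₁₁ M)                   ≈⟨ *-congˡ zA≈Ez ⟩
      x * (E * z)                       ≈⟨ x∙yz≈y∙xz x E z ⟩
      E * (x * z)                       ≈⟨ +-identityʳ _ ⟨
      E * (x * z) + 0#                  ∎)
      where
      x = m₁₁ P
      z = m₂₁ P
      E = m₁₁ M′
      T = m₁₂ M′
      zA≈Ez : z * m₁₁ M ≈ E * z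
      zA≈Ez = begin
        z * m₁₁ M                   ≈⟨ x+y0≈x m₂₁M≈0 ⟨
        z * m₁₁ M + m₂₂ P * m₂₁ M   ≈⟨ proj₁ (proj₂ (proj₂ PM≈M′P)) ⟩
        m₂₁ M′ * x + m₂₂ M′ * z     ≈⟨ 0x+y≈y m₂₁M′≈0 ⟩
        m₂₂ M′ * z                  ≈⟨ *-congʳ m₁₁≈m₂₂ ⟨
        E * z                       ∎

    module _ (m₂₁P≈0 : m₂₁ P ≈ 0#) where

      diagonal₁ : ∀ {u} → Inverses (m₁₁ P) u → m₁₁ M ≈ m₁₁ M′
      diagonal₁ xu≈1 = unit-cancelˡ xu≈1 (begin
        m₁₁ P * m₁₁ M                    ≈⟨ x+y0≈x m₂₁M≈0 ⟨
        m₁₁ P * m₁₁ M + m₁₂ P * m₂₁ M    ≈⟨ proj₁ PM≈M′P ⟩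
        m₁₁ M′ * m₁₁ P + m₁₂ M′ * m₂₁ P  ≈⟨ x+y0≈x m₂₁P≈0 ⟩
        m₁₁ M′ * m₁₁ P                   ≈⟨ *-comm _ _ ⟩
        m₁₁ P * m₁₁ M′                   ∎)

      diagonal₂ : ∀ {u} → Inverses (m₂₂ P) u → m₂₂ M ≈ m₂₂ M′
      diagonal₂ wu≈1 = unit-cancelˡ wu≈1 (begin
        m₂₂ P * m₂₂ M                    ≈⟨ 0x+y≈y m₂₁P≈0 ⟨
        m₂₁ P * m₁₂ M + m₂₂ P * m₂₂ M    ≈⟨ proj₂ (proj₂ (proj₂ PM≈M′P)) ⟩
        m₂₁ M′ * m₁₂ P + m₂₂ M′ * m₂₂ P  ≈⟨ 0x+y≈y m₂₁M′≈0 ⟩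
        m₂₂ M′ * m₂₂ P                   ≈⟨ *-comm _ _ ⟩
        m₂₂ P * m₂₂ M′                   ∎)

    -- In the upper right relation the unknown entry `m₁₂ P` is multiplied by `m₂₂ M` on one side
    -- and by `m₁₁ M′` on the other; when these agree it cancels, leaving `x B = T w`, which is
    -- divided by `w`.
    upper-right : m₂₂ M ≈ m₁₁ M′ → ∀ {u} → Inverses (m₂₂ P) u →
                  (m₁₁ P * u) * m₁₂ M ≈ m₁₂ M′
    upper-right D≈E {u} wu≈1 = unit-cancelʳ wu≈1 (begin
      x * u * B * w      ≈⟨ *-assoc (x * u) B w ⟩
      x * u * (B * w)    ≈⟨ *-assoc x u (B * w) ⟩
      x * (u * (B * w))  ≈⟨ *-congˡ (x∙yz≈y∙xz u B w) ⟩
      x * (B * (u * w))  ≈⟨ *-congˡ (*-congˡ (Inverses-sym wu≈1)) ⟩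
      x * (B * 1#)       ≈⟨ *-congˡ (*-identityʳ B) ⟩
      x * B              ≈⟨ xB≈Tw ⟩
      m₁₂ M′ * w         ∎)
      where
      x = m₁₁ P
      w = m₂₂ P
      B = m₁₂ M
      xB≈Tw : x * B ≈ m₁₂ M′ * w
      xB≈Tw = ∙-cancelˡ (m₁₁ M′ * m₁₂ P) _ _ (begin
        m₁₁ M′ * m₁₂ P + x * B          ≈⟨ +-comm _ _ ⟩
        x * B + m₁₁ M′ * m₁₂ P          ≈⟨ +-congˡ (*-comm _ _) ⟩
        x * B + m₁₂ P * m₁₁ M′          ≈⟨ +-congˡ (*-congˡ D≈E) ⟨
        x * B + m₁₂ P * m₂₂ M           ≈⟨ proj₁ (proj₂ PM≈M′P) ⟩
        m₁₁ M′ * m₁₂ P + m₁₂ M′ * w     ∎)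

  -- The upper right entries of `P *ᴹ M` and `P *ᴹ N` agree; after cancelling the common term
  -- `m₁₁ M′ * m₁₂ P`, the unit `m₂₂ P` is divided out. This serves to compare the second reduction
  -- at an inertial element and at its conjugate.
  upper-right-unique : ∀ P M N M′ N′ → P *ᴹ M ≈ᴹ M′ *ᴹ P → P *ᴹ N ≈ᴹ N′ *ᴹ P → M ≈ᴹ N →
                       m₁₁ M′ ≈ m₁₁ N′ → ∀ {u} → Inverses (m₂₂ P) u → m₁₂ M′ ≈ m₁₂ N′
  upper-right-unique P M N M′ N′ PM≈M′P PN≈N′P (_ , M≈N₁₂ , _ , M≈N₂₂) M′≈N′ wu≈1 =
    unit-cancelʳ wu≈1 (∙-cancelˡ (m₁₁ M′ * m₁₂ P) _ _ (begin
      m₁₁ M′ * m₁₂ P + m₁₂ M′ * m₂₂ P  ≈⟨ proj₁ (proj₂ PM≈M′P) ⟨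
      m₁₁ P * m₁₂ M + m₁₂ P * m₂₂ M    ≈⟨ +-cong (*-congˡ M≈N₁₂) (*-congˡ M≈N₂₂) ⟩
      m₁₁ P * m₁₂ N + m₁₂ P * m₂₂ N    ≈⟨ proj₁ (proj₂ PN≈N′P) ⟩
      m₁₁ N′ * m₁₂ P + m₁₂ N′ * m₂₂ P  ≈⟨ +-congʳ (*-congʳ M′≈N′) ⟨
      m₁₁ M′ * m₁₂ P + m₁₂ N′ * m₂₂ P  ∎))

  module _ (P : M₂ Carrier) (m₂₁P≈0 : m₂₁ P ≈ 0#) (P∈GL₂ : P ∈ InGL₂) where

    -- The two products with the inverse are used one each: `m₂₁ P` occurs in the upper left entry
    -- of `P′ *ᴹ P` and in the lower right entry of `P *ᴹ P′`, so both reduce to a single product.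
    unit₁₁ : Inverses (m₁₁ P) (m₁₁ (proj₁ P∈GL₂))
    unit₁₁ = Inverses-sym (begin
      m₁₁ P′ * m₁₁ P                   ≈⟨ x+y0≈x m₂₁P≈0 ⟨
      m₁₁ P′ * m₁₁ P + m₁₂ P′ * m₂₁ P  ≈⟨ proj₁ (proj₂ (proj₂ P∈GL₂)) ⟩
      1#                               ∎)
      where P′ = proj₁ P∈GL₂

    unit₂₂ : Inverses (m₂₂ P) (m₂₂ (proj₁ P∈GL₂))
    unit₂₂ = begin
      m₂₂ P * m₂₂ P′                   ≈⟨ 0x+y≈y m₂₁P≈0 ⟨
      m₂₁ P * m₁₂ P′ + m₂₂ P * m₂₂ P′  ≈⟨ proj₂ (proj₂ (proj₂ (proj₁ (proj₂ P∈GL₂)))) ⟩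
      1#                               ∎
      where P′ = proj₁ P∈GL₂

  diag∈GL₂ : ∀ {u u⁻¹} → Inverses u u⁻¹ → diag u 1# ∈ InGL₂
  diag∈GL₂ {u} {u⁻¹} uu⁻¹≈1 = diag u⁻¹ 1# , product uu⁻¹≈1 , product (Inverses-sym uu⁻¹≈1)
    where
    product : ∀ {a b} → Inverses a b → diag a 1# *ᴹ diag b 1# ≈ᴹ 1ᴹ
    product {a} ab≈1 =
      trans (x+y0≈x refl) ab≈1 ,
      trans x+0y≈x (zeroʳ a) ,
      trans (0x+y≈y refl) (*-identityˡ 0#) ,
      trans (0x+y≈y refl) (*-identityˡ 1#)

  diag-intertwines : ∀ {u} M M′ → m₁₁ M ≈ m₁₁ M′ → u * m₁₂ M ≈ m₁₂ M′ →
                     m₂₁ M ≈ 0# → m₂₁ M′ ≈ 0# → m₂₂ M ≈ m₂₂ M′ →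
                     diag u 1# *ᴹ M ≈ᴹ M′ *ᴹ diag u 1#
  diag-intertwines M M′ A≈E uB≈T C≈0 C′≈0 D≈G =
    trans x+0y≈x (trans (*-congˡ A≈E) (trans (*-comm _ _) (sym (x+y0≈x refl)))) ,
    trans x+0y≈x (trans uB≈T (sym (trans x0+y≈y (*-identityʳ _)))) ,
    trans (0x+y≈y refl) (trans (trans (*-congˡ C≈0) (zeroʳ 1#))
                               (sym (trans (0x+y≈y C′≈0) (zeroʳ (m₂₂ M′))))) ,
    trans (0x+y≈y refl) (trans (*-comm _ _) (trans (*-congʳ D≈G) (sym x0+y≈y)))

-- Arithmetic modulo the maximal ideal of a ring of integers.

module ResidueFieldProperties {C : AlgebraicClosureOfℚₚ p c e s} (L : FiniteExtension C) where
  open AlgebraicClosureOfℚₚ C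
  open FiniteExtension L
  open RingOfIntegers L
  open ValuationProperties valuedField
  open RingProperties ring using (-0#≈0#; x[y-z]≈xy-xz)
  open SemiringMult semiring using (×1-homo-*)
  private
    module κ = CommutativeRing residueField
    module κᵘ = Units residueField

  x-0≈x : ∀ x → x - 0# ≈ x
  x-0≈x x = trans (+-congˡ -0#≈0#) (+-identityʳ x)

  𝒪-resp : ∀ {x y} → x ≈ y → x ∈ 𝒪 → y ∈ 𝒪
  𝒪-resp x≈y (x∈ , 0≤vx) = resp x≈y x∈ , 0≤-resp x≈y 0≤vx

  1∉𝔪 : ¬ (1# ∈ 𝔪)
  1∉𝔪 (_ , 0<v1) with ≡.subst (0∞ <∞_) v-1 0<v1
  ... | <∞.[ 0<0 ] = ℚ.<-irrefl ≡.refl 0<0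

  ≡-sym : ∀ {x y} → x ≡ y mod𝔪 → y ≡ x mod𝔪
  ≡-sym {x} {y} x≡y = 𝔪-resp (neg-diff x y) (𝔪-neg x≡y)

  ≡-trans : ∀ {x y z} → x ≡ y mod𝔪 → y ≡ z mod𝔪 → x ≡ z mod𝔪
  ≡-trans {x} {y} {z} x≡y y≡z = 𝔪-resp (telescope x y z) (𝔪-+ x≡y y≡z)

  ≡-*ˡ : ∀ {x y z} → x ∈ 𝒪 → y ≡ z mod𝔪 → x * y ≡ x * z mod𝔪
  ≡-*ˡ {x} {y} {z} x∈𝒪 y≡z = 𝔪-resp (x[y-z]≈xy-xz x y z) (𝔪-* x∈𝒪 y≡z)

  ≡0⇒∈𝔪 : ∀ {x} → x ≡ 0# mod𝔪 → x ∈ 𝔪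
  ≡0⇒∈𝔪 {x} = 𝔪-resp (x-0≈x x)

  ∈𝔪⇒≡0 : ∀ {x} → x ∈ 𝔪 → x ≡ 0# mod𝔪
  ∈𝔪⇒≡0 {x} = 𝔪-resp (sym (x-0≈x x))

  -- The ring of integers is local: a nonnegative value is either positive or 0, and in the second
  -- case `v x +∞ v (x ⁻¹) ≡ v 1#` forces the inverse to have value 0 too.
  𝔪⊎⁻¹∈𝒪 : ∀ {x} → x ∈ 𝒪 → x ∈ 𝔪 ⊎ (x ⁻¹ ∈ 𝒪 × x * x ⁻¹ ≈ 1#)
  𝔪⊎⁻¹∈𝒪 {x} (x∈ , 0≤vx) = cases (v x) ≡.refl
    where
    positive : ∀ {r} → v x ≡ r → 0∞ <∞ r → x ∈ 𝔪
    positive vx≡r 0<r = x∈ , ≡.subst (0∞ <∞_) (≡.sym vx≡r) 0<r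

    cases : ∀ r → v x ≡ r → x ∈ 𝔪 ⊎ (x ⁻¹ ∈ 𝒪 × x * x ⁻¹ ≈ 1#)
    cases ⊤⁺    vx≡∞ = inj₁ (positive vx≡∞ <∞.[ ℚ.0ℚ ]<⊤⁺)
    cases [ r ] vx≡r with ≡.subst (0∞ ≤∞_) vx≡r 0≤vx | ℚ.<-cmp ℚ.0ℚ r
    ... | _           | tri< 0<r _ _ = inj₁ (positive vx≡r <∞.[ 0<r ])
    ... | ≤∞.[ 0≤r ]  | tri> _ _ r<0 = ⊥-elim (ℚ.<-irrefl ≡.refl (ℚ.≤-<-trans 0≤r r<0))
    ... | _           | tri≈ _ ≡.refl _ = inj₂
      ((⁻¹∈ x∈ , ≡.subst (0∞ ≤∞_) (≡.sym vx⁻¹≡0) ≤∞-refl) , xx⁻¹≈1)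
      where
      xx⁻¹≈1 : x * x ⁻¹ ≈ 1#
      xx⁻¹≈1 = inverseʳ λ x≈0 → ∞≢0 (≡.trans (≡.sym v-0) (≡.trans (≡.sym (v-cong x≈0)) vx≡r))
        where
        ∞≢0 : ¬ (⊤⁺ ≡ 0∞)
        ∞≢0 ()
      vx⁻¹≡0 : v (x ⁻¹) ≡ 0∞
      vx⁻¹≡0 = ≡.trans (≡.sym (0+∞ (v (x ⁻¹))))
        (≡.trans (≡.cong (_+∞ v (x ⁻¹)) (≡.sym vx≡r))
        (≡.trans (≡.sym (v-* x (x ⁻¹))) (≡.trans (v-cong xx⁻¹≈1) v-1)))

  -- A unit modulo `𝔪` lifts to a true unit: a representative in `𝔪` would put 1 into `𝔪`.
  residueUnit : ∀ {x y} → κᵘ.Inverses x y → (proj₁ x) ⁻¹ ∈ 𝒪 × proj₁ x * (proj₁ x) ⁻¹ ≈ 1#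
  residueUnit {x , x∈𝒪} {y , y∈𝒪} xy≡1 with 𝔪⊎⁻¹∈𝒪 x∈𝒪
  ... | inj₂ x⁻¹∈𝒪 = x⁻¹∈𝒪
  ... | inj₁ x∈𝔪   = ⊥-elim (1∉𝔪 (≡0⇒∈𝔪 (≡-trans (≡-sym xy≡1)
                       (∈𝔪⇒≡0 (𝔪-resp (*-comm y x) (𝔪-* y∈𝒪 x∈𝔪))))))

  residueUnit⇒𝒪ˣ : ∀ {x y} → κᵘ.Inverses x y → proj₁ x ∈ 𝒪ˣ
  residueUnit⇒𝒪ˣ {x} {y} xy≡1 =
    let x⁻¹∈𝒪 , xx⁻¹≈1 = residueUnit {x} {y} xy≡1 in proj₂ x , _ , x⁻¹∈𝒪 , xx⁻¹≈1

  -- Otherwise `x ⁻¹` is integral, and multiplying the square by it recovers `x`.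
  square∈𝔪 : ∀ {x} → x ∈ 𝒪 → x * x ∈ 𝔪 → x ∈ 𝔪
  square∈𝔪 {x} x∈𝒪 x²∈𝔪 with 𝔪⊎⁻¹∈𝒪 x∈𝒪
  ... | inj₁ x∈𝔪             = x∈𝔪
  ... | inj₂ (x⁻¹∈𝒪 , xx⁻¹≈1) = 𝔪-resp x⁻¹x²≈x (𝔪-* x⁻¹∈𝒪 x²∈𝔪)
    where
    x⁻¹x²≈x : x ⁻¹ * (x * x) ≈ x
    x⁻¹x²≈x = trans (sym (*-assoc _ _ _))
      (trans (*-congʳ (trans (*-comm _ _) xx⁻¹≈1)) (*-identityˡ x))

  fromℕ∈𝒪 : ∀ n → fromℕ n ∈ 𝒪
  fromℕ∈𝒪 zero    = 𝒪-0
  fromℕ∈𝒪 (suc n) = 𝒪-+ 𝒪-1 (fromℕ∈𝒪 n)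

  -- Here `p` is the residue characteristic of `L`; for `K` it becomes `ℓ`. The normalisation `v-p`
  -- makes its value 1, hence positive.
  p∣n⇒fromℕ∈𝔪 : ∀ {n} → p ℕ.∣ n → fromℕ n ∈ 𝔪
  p∣n⇒fromℕ∈𝔪 (divides m ≡.refl) = 𝔪-resp (sym (×1-homo-* m p)) (𝔪-* (fromℕ∈𝒪 m)
    (proj₁ (fromℕ∈𝒪 p) , ≡.subst (0∞ <∞_) (≡.sym v-p) <∞.[ ℚ.positive⁻¹ ℚ.1ℚ ]))
    where open IsPAdicCompletion isCompletion

  fromℕ∈𝔪⇒p∣n : ∀ {n} → fromℕ n ∈ 𝔪 → p ℕ.∣ n
  fromℕ∈𝔪⇒p∣n {n} (_ , 0<vn) with p ∣? n
  ... | yes p∣n = p∣n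
  ... | no  p∤n with ≡.subst (0∞ <∞_) (IsPAdicCompletion.v-coprime isCompletion p∤n) 0<vn
  ...   | <∞.[ 0<0 ] = ⊥-elim (ℚ.<-irrefl ≡.refl 0<0)

  -- Negative exponents reduce to positive ones: `y ≡ 1# mod𝔪` makes `y` a unit, and then `y ⁻¹` is
  -- congruent to `y ⁻¹ * y`.
  ^ℤ≡1 : ∀ {x} → x ∈ 𝒪 → x ≡ 1# mod𝔪 → ∀ k → x ^ℤ k ≡ 1# mod𝔪
  ^ℤ≡1 {x} x∈𝒪 x≡1 = cases
    where
    ^∈𝒪 : ∀ n → x ^ℤ (+ n) ∈ 𝒪
    ^∈𝒪 zero    = 𝒪-1
    ^∈𝒪 (suc n) = 𝒪-* x∈𝒪 (^∈𝒪 n)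

    ≡1 : ∀ n → x ^ℤ (+ n) ≡ 1# mod𝔪
    ≡1 zero    = ≈⇒≡ refl
    ≡1 (suc n) = ≡-trans (≡-*ˡ x∈𝒪 (≡1 n)) (≡-trans (≈⇒≡ (*-identityʳ x)) x≡1)

    inverse : ∀ {y} → y ∈ 𝒪 → y ≡ 1# mod𝔪 → y ⁻¹ ≡ 1# mod𝔪
    inverse {y} y∈𝒪 y≡1 =
      let y⁻¹∈𝒪 , yy⁻¹≈1 = residueUnit {y , y∈𝒪} {κ.1#} (≡-trans (≈⇒≡ (*-identityʳ y)) y≡1)
      in ≡-trans (≈⇒≡ (sym (*-identityʳ (y ⁻¹)))) (≡-trans (≡-*ˡ y⁻¹∈𝒪 (≡-sym y≡1))
           (≈⇒≡ (trans (*-comm (y ⁻¹) y) yy⁻¹≈1)))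

    cases : ∀ k → x ^ℤ k ≡ 1# mod𝔪
    cases (+ n)    = ≡1 n
    cases -[1+ n ] = inverse (^∈𝒪 (suc n)) (≡1 (suc n))

-- Frobenius powers and inertia in the Weil group.

module WeilGroupProperties {C : AlgebraicClosureOfℚₚ p c e s} (F : FiniteExtension C)
    (Φ : GaloisGroup.Automorphism F) where
  open GaloisGroup F
  open WeilGroup Φ
  private
    module W = Group W-group
    module Gal = Group Gal
  open IntegerPowerProperties Gal using () renaming (_^ℤ_ to _^ᴳ_)

  -- An element acting on the residue field as the `k`-th power of `Φ` becomes inertial after
  -- multiplication by the inverse of that power. Formulas known only on `Φ^ k ∙ τ` thereby reach
  -- the whole Weil group.
  Φ^∙-decomposition : ∀ g → ∃[ k ] ∃[ τ ] g W.≈ (Φ^ k ∙ τ)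
  Φ^∙-decomposition (σ , k , σ~Φᵏ) = k , (Φ⁻ᵏ Gal.∙ σ , inertial) , λ x →
    AlgebraicClosureOfℚₚ.sym C (Gal.inverseʳ (Φ ^ᴳ k) (⟦ σ ⟧ x))
    where
    Φ⁻ᵏ : Automorphism
    Φ⁻ᵏ = (Φ ^ᴳ k) Gal.⁻¹
    inertial : Φ⁻ᵏ Gal.∙ σ ∈ Inertial
    inertial = same-resp {Φ⁻ᵏ Gal.∙ σ} {Φ⁻ᵏ Gal.∙ (Φ ^ᴳ k)} {Gal.ε}
      (∙-same {Φ⁻ᵏ} {Φ⁻ᵏ} {σ} {Φ ^ᴳ k} (λ _ _ → ≡̄-reflexive (AlgebraicClosureOfℚₚ.refl C)) σ~Φᵏ)
      (Gal.inverseˡ (Φ ^ᴳ k))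

  Φ^0∙conj : ∀ g τ → (Φ^ (+ 0) ∙ conj g τ) W.≈ ((g W.∙ (Φ^ (+ 0) ∙ τ)) W.∙ (g W.⁻¹))
  Φ^0∙conj g τ x = AlgebraicClosureOfℚₚ.refl C

-- Characters of the Weil group and the condition q ≡ 1 modulo ℓ.

module SettingProperties (S : Setting p ℓ c e s c′ e′ s′) where
  open Setting S
  open WeilGroupProperties F Φ
  open ResidueFieldProperties K
  private
    module W = Group W-group

  module _ (ψ : Character) where
    private
      module ψ = IsMonoidHomomorphism (Character.isHom ψ)

    χ-inverse : ∀ g → χ⟪ ψ ⟫ g * χ⟪ ψ ⟫ (g W.⁻¹) ≈ 1#
    χ-inverse g = trans (sym (ψ.homo g (g W.⁻¹))) (trans (ψ.⟦⟧-cong (W.inverseʳ g)) ψ.ε-homo)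

    -- The values of `ψ` commute, so those at `g` and at its inverse cancel.
    χ-conj : ∀ g τ → χ⟪ ψ ⟫ (Φ^ (+ 0) ∙ conj g τ) ≈ χ⟪ ψ ⟫ (Φ^ (+ 0) ∙ τ)
    χ-conj g τ = begin
      χ⟪ ψ ⟫ (Φ^ (+ 0) ∙ conj g τ)                            ≈⟨ ψ.⟦⟧-cong (Φ^0∙conj g τ) ⟩
      χ⟪ ψ ⟫ ((g W.∙ (Φ^ (+ 0) ∙ τ)) W.∙ g W.⁻¹)              ≈⟨ ψ.homo _ _ ⟩
      χ⟪ ψ ⟫ (g W.∙ (Φ^ (+ 0) ∙ τ)) * χ⟪ ψ ⟫ (g W.⁻¹)         ≈⟨ *-congʳ (ψ.homo _ _) ⟩
      χ⟪ ψ ⟫ g * χ⟪ ψ ⟫ (Φ^ (+ 0) ∙ τ) * χ⟪ ψ ⟫ (g W.⁻¹)      ≈⟨ xy∙z≈y∙xz _ _ _ ⟩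
      χ⟪ ψ ⟫ (Φ^ (+ 0) ∙ τ) * (χ⟪ ψ ⟫ g * χ⟪ ψ ⟫ (g W.⁻¹))    ≈⟨ *-congˡ (χ-inverse g) ⟩
      χ⟪ ψ ⟫ (Φ^ (+ 0) ∙ τ) * 1#                              ≈⟨ *-identityʳ _ ⟩
      χ⟪ ψ ⟫ (Φ^ (+ 0) ∙ τ)                                   ∎
      where
      open CommutativeSemigroupProperties *-commutativeSemigroup using (xy∙z≈y∙xz)
      open SetoidReasoning setoid

  q≡1⇒ω≡1 : fromℕ q ≡ 1# mod𝔪 → ∀ g → ω g ≡ 1# mod𝔪
  q≡1⇒ω≡1 q≡1 g =
    let k , τ , g≈Φᵏτ = Φ^∙-decomposition g
        ωg≈q⁻ᵏ = trans (IsMonoidHomomorphism.⟦⟧-cong (Character.isHom ωᶜ) g≈Φᵏτ) (ω-value k τ)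
    in 𝔪-resp (+-congʳ (sym ωg≈q⁻ᵏ)) (^ℤ≡1 (fromℕ∈𝒪 q) q≡1 (ℤ.- k))

  -- A residue field contains 0, so it is not empty. With `q` in the form `suc r`, the integer
  -- `+ q ℤ.- + 1` computes to `+ r`, and divisibility becomes one of natural numbers.
  q-nonzero : ∃[ r ] q ≡ suc r
  q-nonzero = nonempty q q-order
    where
    nonempty : ∀ n → ResidueFieldOfOrder F n → ∃[ r ] n ≡ suc r
    nonempty (suc r) _ = r , ≡.refl
    nonempty zero    b
      with () ← proj₁ (Bijection.surjective b (CommutativeRing.0# (RingOfIntegers.residueField F)))

  y·ω≡y : (∀ g → ω g ≡ 1# mod𝔪) → ∀ {y} g → y ∈ 𝒪 → y * ω g ≡ y mod𝔪
  y·ω≡y ω≡1 g y∈𝒪 = ≡-trans (≡-*ˡ y∈𝒪 (ω≡1 g)) (≈⇒≡ (*-identityʳ _))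

  1+x-1≈x : ∀ x → (1# + x) - 1# ≈ x
  1+x-1≈x x = trans (+-congʳ (+-comm 1# x))
    (trans (+-assoc x 1# (- 1#)) (trans (+-congˡ (-‿inverseʳ 1#)) (+-identityʳ x)))

  ℓ∣q-1⇒q≡1 : + ℓ ∣ + q ℤ.- + 1 → fromℕ q ≡ 1# mod𝔪
  ℓ∣q-1⇒q≡1 = go q-nonzero
    where
    go : ∀ {n} → ∃[ r ] n ≡ suc r → + ℓ ∣ + n ℤ.- + 1 → fromℕ n ≡ 1# mod𝔪
    go (r , ≡.refl) ℓ∣r = 𝔪-resp (sym (1+x-1≈x (fromℕ r))) (p∣n⇒fromℕ∈𝔪 ℓ∣r)

  q≡1⇒ℓ∣q-1 : fromℕ q ≡ 1# mod𝔪 → + ℓ ∣ + q ℤ.- + 1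
  q≡1⇒ℓ∣q-1 = go q-nonzero
    where
    go : ∀ {n} → ∃[ r ] n ≡ suc r → fromℕ n ≡ 1# mod𝔪 → + ℓ ∣ + n ℤ.- + 1
    go (r , ≡.refl) n≡1 = fromℕ∈𝔪⇒p∣n (𝔪-resp (1+x-1≈x (fromℕ r)) n≡1)

-- The two representations in triangular form and their reductions.

module TriangularReductions (S : Setting p ℓ c e s c′ e′ s′) where
  open Setting S
  open WeilGroupProperties F Φ
  open ResidueFieldProperties K
  open SettingProperties S
  private
    module κ  = CommutativeRing residueField
    module κᵘ = Units residueField
    module κⁱ = Intertwiners residueField
    module W  = Group W-group

  _·ω : Character → W → Carrier
  (χ ·ω) g = χ⟪ χ ⟫ g * ω g

  -- For `γ = b₁ / d₁`, the upper right entry of the diagonal representation conjugated by the first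
  -- triangular matrix.
  principalCocycle : Carrier → Character → Character → W → Carrier
  principalCocycle γ χ₁ χ₂ g = γ * (χ⟪ χ₂ ⟫ g - χ⟪ χ₁ ⟫ g)

  -- For `α = a₂ / d₂` and `δ = b₂ / d₂`, the analogous entry for the special representation; the
  -- `tℓ` term comes from the monodromy.
  specialCocycle : Carrier → Carrier → Character → ℤ → I → Carrier
  specialCocycle α δ χ k τ = α * tℓ τ * (χ ·ω) g + δ * (χ⟪ χ ⟫ g - (χ ·ω) g)
    where g = Φ^ k ∙ τ

  module Reductions
    (ρ₁ ρ₂ : Representation) (int₁ : Integral ρ₁) (int₂ : Integral ρ₂)
    (χ₁ χ₂ χ : Character) (γ α δ : Carrier) (α∈𝒪ˣ : α ∈ 𝒪ˣ)
    (ρ₁≈ : ∀ g → ρ⟪ ρ₁ ⟫ g ≈ᴹ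
             mat (χ⟪ χ₁ ⟫ g) (principalCocycle γ χ₁ χ₂ g) 0# (χ⟪ χ₂ ⟫ g))
    (ρ₂≈ : ∀ k τ → ρ⟪ ρ₂ ⟫ (Φ^ k ∙ τ) ≈ᴹ
             mat ((χ ·ω) (Φ^ k ∙ τ)) (specialCocycle α δ χ k τ) 0# (χ⟪ χ ⟫ (Φ^ k ∙ τ)))
    where

    private
      χω = χ ·ω
      β  = principalCocycle γ χ₁ χ₂
      β₂ = specialCocycle α δ χ

    ρ̄₁ ρ̄₂ : W → M₂ κ.Carrier
    ρ̄₁ = reduction ρ₁ int₁
    ρ̄₂ = reduction ρ₂ int₂

    -- Only the upper right entry of `ρ₂≈` refers to `k` and `τ` separately; the other three
    -- transport to any `g` along its decomposition.
    ρ₂-triangular : ∀ g → ρ⟪ ρ₂ ⟫ g ≈ᴹ mat (χω g) (m₁₂ (ρ⟪ ρ₂ ⟫ g)) 0# (χ⟪ χ ⟫ g)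
    ρ₂-triangular g with Φ^∙-decomposition g
    ... | k , τ , g≈Φᵏτ =
      let a , _ , c , d    = IsMonoidHomomorphism.⟦⟧-cong (Representation.isHom ρ₂) g≈Φᵏτ
          a′ , _ , c′ , d′ = ρ₂≈ k τ
          χ-cong           = IsMonoidHomomorphism.⟦⟧-cong (Character.isHom χ) g≈Φᵏτ
          ω-cong           = IsMonoidHomomorphism.⟦⟧-cong (Character.isHom ωᶜ) g≈Φᵏτ
      in trans a (trans a′ (sym (*-cong χ-cong ω-cong))) , refl ,
         trans c c′ , trans d (trans d′ (sym χ-cong))

    χ∈𝒪 : ∀ g → χ⟪ χ ⟫ g ∈ 𝒪
    χ∈𝒪 g = 𝒪-resp (proj₂ (proj₂ (proj₂ (ρ₂-triangular g)))) (proj₂ (proj₂ (proj₂ (proj₁ (int₂ g)))))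

    χω-inertia : ∀ τ → χω (Φ^ (+ 0) ∙ τ) ≈ χ⟪ χ ⟫ (Φ^ (+ 0) ∙ τ)
    χω-inertia τ = trans (*-congˡ (ω-value (+ 0) τ)) (*-identityʳ _)

    -- On inertia `ω` is 1, so the `δ` term vanishes.
    β₂-inertia : ∀ τ → β₂ (+ 0) τ ≈ α * tℓ τ * χ⟪ χ ⟫ (Φ^ (+ 0) ∙ τ)
    β₂-inertia τ = begin
      α * tℓ τ * χω g + δ * (χ⟪ χ ⟫ g - χω g)
        ≈⟨ +-cong (*-congˡ χω≈χ) (*-congˡ (+-congˡ (-‿cong χω≈χ))) ⟩
      α * tℓ τ * χ⟪ χ ⟫ g + δ * (χ⟪ χ ⟫ g - χ⟪ χ ⟫ g) ≈⟨ +-congˡ (*-congˡ (-‿inverseʳ _)) ⟩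
      α * tℓ τ * χ⟪ χ ⟫ g + δ * 0#                    ≈⟨ +-congˡ (zeroʳ δ) ⟩
      α * tℓ τ * χ⟪ χ ⟫ g + 0#                        ≈⟨ +-identityʳ _ ⟩
      α * tℓ τ * χ⟪ χ ⟫ g                             ∎
      where
      open SetoidReasoning setoid
      g = Φ^ (+ 0) ∙ τ
      χω≈χ = χω-inertia τ

    m₂₁ρ̄₁≡0 : ∀ g → m₂₁ (ρ̄₁ g) κ.≈ κ.0#
    m₂₁ρ̄₁≡0 g = ≈⇒≡ (proj₁ (proj₂ (proj₂ (ρ₁≈ g))))

    m₂₁ρ̄₂≡0 : ∀ g → m₂₁ (ρ̄₂ g) κ.≈ κ.0#
    m₂₁ρ̄₂≡0 g = ≈⇒≡ (proj₁ (proj₂ (proj₂ (ρ₂-triangular g))))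

    m₁₁ρ̄₁≡χ₁ : ∀ g → proj₁ (m₁₁ (ρ̄₁ g)) ≡ χ⟪ χ₁ ⟫ g mod𝔪
    m₁₁ρ̄₁≡χ₁ g = ≈⇒≡ (proj₁ (ρ₁≈ g))

    m₂₂ρ̄₁≡χ₂ : ∀ g → proj₁ (m₂₂ (ρ̄₁ g)) ≡ χ⟪ χ₂ ⟫ g mod𝔪
    m₂₂ρ̄₁≡χ₂ g = ≈⇒≡ (proj₂ (proj₂ (proj₂ (ρ₁≈ g))))

    m₁₁ρ̄₂≡χω : ∀ g → proj₁ (m₁₁ (ρ̄₂ g)) ≡ χω g mod𝔪
    m₁₁ρ̄₂≡χω g = ≈⇒≡ (proj₁ (ρ₂-triangular g))

    m₂₂ρ̄₂≡χ : ∀ g → proj₁ (m₂₂ (ρ̄₂ g)) ≡ χ⟪ χ ⟫ g mod𝔪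
    m₂₂ρ̄₂≡χ g = ≈⇒≡ (proj₂ (proj₂ (proj₂ (ρ₂-triangular g))))

    -- From an isomorphism of the reductions to the congruences.

    module Necessity (P : M₂ κ.Carrier) (P∈GL₂ : P ∈ k.InGL₂)
             (Pρ̄₁≈ρ̄₂P : ∀ g → P k.*ᴹ ρ̄₁ g k.≈ᴹ ρ̄₂ g k.*ᴹ P) where

      τ₁ : I
      τ₁ = proj₁ (IsTameCharacter.surjective tℓ-tame
             (Subfield.1∈ ℚₚ , proj₂ 𝒪-1))

      tℓτ₁≈1 : tℓ τ₁ ≈ 1#
      tℓτ₁≈1 = proj₂ (IsTameCharacter.surjective tℓ-tame (Subfield.1∈ ℚₚ , proj₂ 𝒪-1))

      -- Conjugation is by the inverse of Frobenius because `ω` takes the value `q` there, so `tℓ`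
      -- of the conjugate of `τ₁` is `q` itself and not its inverse.
      Φ⁻¹ g₀ g₁ : W
      Φ⁻¹ = Φ^ -[1+ 0 ] ∙ Group.ε I-group
      g₀  = Φ^ (+ 0) ∙ τ₁
      g₁  = Φ^ (+ 0) ∙ conj Φ⁻¹ τ₁

      ᾱ ᾱ⁻¹ χ̄₀ χ̄₀⁻¹ ᾱχ̄₀ q̄ : κ.Carrier
      ᾱ     = α , proj₁ α∈𝒪ˣ
      ᾱ⁻¹   = proj₁ (proj₂ α∈𝒪ˣ) , proj₁ (proj₂ (proj₂ α∈𝒪ˣ))
      χ̄₀    = χ⟪ χ ⟫ g₀ , χ∈𝒪 g₀
      χ̄₀⁻¹  = χ⟪ χ ⟫ (g₀ W.⁻¹) , χ∈𝒪 (g₀ W.⁻¹)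
      ᾱχ̄₀   = ᾱ κ.* χ̄₀
      q̄     = fromℕ q , fromℕ∈𝒪 q

      ᾱχ̄₀-unit : κᵘ.Inverses ᾱχ̄₀ (ᾱ⁻¹ κ.* χ̄₀⁻¹)
      ᾱχ̄₀-unit = κᵘ.Inverses-* {ᾱ} {ᾱ⁻¹} {χ̄₀} {χ̄₀⁻¹}
        (≈⇒≡ (proj₂ (proj₂ (proj₂ α∈𝒪ˣ)))) (≈⇒≡ (χ-inverse χ g₀))

      -- The factor `κ.1#` is the value of `tℓ` at `τ₁`; it is kept so that the comparison with
      -- `T₁≡ᾱχ̄₀q̄` is a cancellation of the unit `ᾱχ̄₀`.
      T₀≡ᾱχ̄₀ : m₁₂ (ρ̄₂ g₀) κ.≈ ᾱχ̄₀ κ.* κ.1#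
      T₀≡ᾱχ̄₀ = ≈⇒≡ (trans (proj₁ (proj₂ (ρ₂≈ (+ 0) τ₁))) (trans (β₂-inertia τ₁)
        (trans (*-congʳ (trans (*-congˡ tℓτ₁≈1) (*-identityʳ α))) (sym (*-identityʳ _)))))

      T₁≡ᾱχ̄₀q̄ : m₁₂ (ρ̄₂ g₁) κ.≈ ᾱχ̄₀ κ.* q̄
      T₁≡ᾱχ̄₀q̄ = ≈⇒≡ (begin
        m₁₂ (ρ⟪ ρ₂ ⟫ g₁)                   ≈⟨ proj₁ (proj₂ (ρ₂≈ (+ 0) (conj Φ⁻¹ τ₁))) ⟩
        β₂ (+ 0) (conj Φ⁻¹ τ₁)             ≈⟨ β₂-inertia (conj Φ⁻¹ τ₁) ⟩
        α * tℓ (conj Φ⁻¹ τ₁) * χ⟪ χ ⟫ g₁   ≈⟨ *-cong (*-congˡ t≈q) (χ-conj χ Φ⁻¹ τ₁) ⟩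
        α * fromℕ q * χ⟪ χ ⟫ g₀            ≈⟨ xy∙z≈xz∙y _ _ _ ⟩
        α * χ⟪ χ ⟫ g₀ * fromℕ q            ∎)
        where
        open SetoidReasoning setoid
        open CommutativeSemigroupProperties *-commutativeSemigroup using (xy∙z≈xz∙y)
        t≈q : tℓ (conj Φ⁻¹ τ₁) ≈ fromℕ q
        t≈q = trans (tℓ-conj Φ⁻¹ τ₁) (trans (*-cong (ω-value -[1+ 0 ] (Group.ε I-group)) tℓτ₁≈1)
                (trans (*-identityʳ _) (*-identityʳ _)))

      -- At the inertial `g₀` the diagonal entries of `ρ̄₂` agree, as `lower-left` requires. The
      -- unit `ᾱχ̄₀` cancels, and a square in `𝔪` has its root in `𝔪`.
      m₂₁P≡0 : m₂₁ P κ.≈ κ.0#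
      m₂₁P≡0 = ∈𝔪⇒≡0 (square∈𝔪 (proj₂ z) (≡0⇒∈𝔪
        (κᵘ.unit-cancelˡ {ᾱχ̄₀} {ᾱ⁻¹ κ.* χ̄₀⁻¹} ᾱχ̄₀-unit {z κ.* z} {κ.0#} (begin
          ᾱχ̄₀ κ.* (z κ.* z)           ≈⟨ κ.*-congʳ {z κ.* z} {ᾱχ̄₀ κ.* κ.1#} {ᾱχ̄₀} (κ.*-identityʳ ᾱχ̄₀) ⟨
          ᾱχ̄₀ κ.* κ.1# κ.* (z κ.* z)  ≈⟨ κ.*-congʳ {z κ.* z} {T₀} {ᾱχ̄₀ κ.* κ.1#} T₀≡ᾱχ̄₀ ⟨
          T₀ κ.* (z κ.* z)            ≈⟨ κⁱ.lower-left P (ρ̄₁ g₀) (ρ̄₂ g₀) (Pρ̄₁≈ρ̄₂P g₀)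
                                           (m₂₁ρ̄₁≡0 g₀) (m₂₁ρ̄₂≡0 g₀) E≡G ⟩
          κ.0#                        ≈⟨ κ.zeroʳ ᾱχ̄₀ ⟨
          ᾱχ̄₀ κ.* κ.0#                ∎))))
        where
        open SetoidReasoning κ.setoid
        z T₀ : κ.Carrier
        z = m₂₁ P
        T₀ = m₁₂ (ρ̄₂ g₀)
        E≡G : m₁₁ (ρ̄₂ g₀) κ.≈ m₂₂ (ρ̄₂ g₀)
        E≡G = ≡-trans (m₁₁ρ̄₂≡χω g₀) (≡-trans (≈⇒≡ (χω-inertia τ₁)) (≡-sym (m₂₂ρ̄₂≡χ g₀)))

      P′ : M₂ κ.Carrier
      P′ = proj₁ P∈GL₂

      m₁₁P-unit : κᵘ.Inverses (m₁₁ P) (m₁₁ P′)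
      m₁₁P-unit = κⁱ.unit₁₁ P m₂₁P≡0 P∈GL₂

      m₂₂P-unit : κᵘ.Inverses (m₂₂ P) (m₂₂ P′)
      m₂₂P-unit = κⁱ.unit₂₂ P m₂₁P≡0 P∈GL₂

      -- The first reduction agrees at `g₁` and `g₀`, its entries being built from characters. Hence
      -- the upper right entries of the second agree too, and these are `ᾱχ̄₀` times `q̄` and times
      -- 1.
      q≡1 : fromℕ q ≡ 1# mod𝔪
      q≡1 = κᵘ.unit-cancelˡ {ᾱχ̄₀} {ᾱ⁻¹ κ.* χ̄₀⁻¹} ᾱχ̄₀-unit {q̄} {κ.1#}
        (≡-trans (≡-sym T₁≡ᾱχ̄₀q̄) (≡-trans T₁≡T₀ T₀≡ᾱχ̄₀))
        where
        ρ̄₁-conj : ρ̄₁ g₁ k.≈ᴹ ρ̄₁ g₀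
        ρ̄₁-conj =
          (≡-trans (m₁₁ρ̄₁≡χ₁ g₁) (≡-trans (≈⇒≡ (χ-conj χ₁ Φ⁻¹ τ₁)) (≡-sym (m₁₁ρ̄₁≡χ₁ g₀)))) ,
          ≈⇒≡ (trans (proj₁ (proj₂ (ρ₁≈ g₁)))
                (trans (*-congˡ (+-cong (χ-conj χ₂ Φ⁻¹ τ₁) (-‿cong (χ-conj χ₁ Φ⁻¹ τ₁))))
                       (sym (proj₁ (proj₂ (ρ₁≈ g₀)))))) ,
          ≡-trans (m₂₁ρ̄₁≡0 g₁) (≡-sym (m₂₁ρ̄₁≡0 g₀)) ,
          ≡-trans (m₂₂ρ̄₁≡χ₂ g₁) (≡-trans (≈⇒≡ (χ-conj χ₂ Φ⁻¹ τ₁)) (≡-sym (m₂₂ρ̄₁≡χ₂ g₀)))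

        E₁≡E₀ : m₁₁ (ρ̄₂ g₁) κ.≈ m₁₁ (ρ̄₂ g₀)
        E₁≡E₀ = ≡-trans (m₁₁ρ̄₂≡χω g₁) (≡-trans
          (≈⇒≡ (*-cong (χ-conj χ Φ⁻¹ τ₁) (χ-conj ωᶜ Φ⁻¹ τ₁))) (≡-sym (m₁₁ρ̄₂≡χω g₀)))

        T₁≡T₀ : m₁₂ (ρ̄₂ g₁) κ.≈ m₁₂ (ρ̄₂ g₀)
        T₁≡T₀ = κⁱ.upper-right-unique P (ρ̄₁ g₁) (ρ̄₁ g₀) (ρ̄₂ g₁) (ρ̄₂ g₀)
          (Pρ̄₁≈ρ̄₂P g₁) (Pρ̄₁≈ρ̄₂P g₀) ρ̄₁-conj E₁≡E₀ {m₂₂ P′} m₂₂P-unit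

      χω≡χ : ∀ g → χω g ≡ χ⟪ χ ⟫ g mod𝔪
      χω≡χ g = y·ω≡y (q≡1⇒ω≡1 q≡1) g (χ∈𝒪 g)

      χ≡χ₁ : χ ≡ᶜ χ₁
      χ≡χ₁ g = ≡-trans (≡-sym (χω≡χ g)) (≡-trans (≡-sym (m₁₁ρ̄₂≡χω g)) (≡-trans (≡-sym
        (κⁱ.diagonal₁ P (ρ̄₁ g) (ρ̄₂ g) (Pρ̄₁≈ρ̄₂P g) (m₂₁ρ̄₁≡0 g) (m₂₁ρ̄₂≡0 g) m₂₁P≡0
          {m₁₁ P′} m₁₁P-unit)) (m₁₁ρ̄₁≡χ₁ g)))

      χ≡χ₂ : χ ≡ᶜ χ₂
      χ≡χ₂ g = ≡-trans (≡-sym (m₂₂ρ̄₂≡χ g)) (≡-trans (≡-sym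
        (κⁱ.diagonal₂ P (ρ̄₁ g) (ρ̄₂ g) (Pρ̄₁≈ρ̄₂P g) (m₂₁ρ̄₁≡0 g) (m₂₁ρ̄₂≡0 g) m₂₁P≡0
          {m₂₂ P′} m₂₂P-unit)) (m₂₂ρ̄₁≡χ₂ g))

      x̄ : κ.Carrier
      x̄ = m₁₁ P κ.* m₂₂ P′

      -- `x̄` is the quotient of the diagonal entries of `P`; its inverse modulo `𝔪` is the opposite
      -- quotient, and such a unit lifts.
      x̄-unit : proj₁ x̄ ∈ 𝒪ˣ
      x̄-unit = residueUnit⇒𝒪ˣ {x̄} {m₁₁ P′ κ.* m₂₂ P} (κᵘ.Inverses-* {m₁₁ P} {m₁₁ P′} {m₂₂ P′} {m₂₂ P}
        m₁₁P-unit (κᵘ.Inverses-sym {m₂₂ P} {m₂₂ P′} m₂₂P-unit))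

      x̄β≡β₂ : ∀ k τ → proj₁ x̄ * β (Φ^ k ∙ τ) ≡ β₂ k τ mod𝔪
      x̄β≡β₂ k τ = ≡-trans (≈⇒≡ (*-congˡ (sym (proj₁ (proj₂ (ρ₁≈ g))))))
        (≡-trans (κⁱ.upper-right P (ρ̄₁ g) (ρ̄₂ g) (Pρ̄₁≈ρ̄₂P g) (m₂₁ρ̄₁≡0 g) (m₂₁ρ̄₂≡0 g)
                    D≡E {m₂₂ P′} m₂₂P-unit)
                 (≈⇒≡ (proj₁ (proj₂ (ρ₂≈ k τ)))))
        where
        g = Φ^ k ∙ τ
        -- The hypothesis of `upper-right`: both sides reduce to `χ`, since `ω` is trivial modulo
        -- `𝔪`.
        D≡E : m₂₂ (ρ̄₁ g) κ.≈ m₁₁ (ρ̄₂ g)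
        D≡E = ≡-trans (m₂₂ρ̄₁≡χ₂ g) (≡-trans (≡-sym (χ≡χ₂ g))
                (≡-trans (≡-sym (χω≡χ g)) (≡-sym (m₁₁ρ̄₂≡χω g))))

    -- From the congruences to a diagonal isomorphism.

    isomorphic : fromℕ q ≡ 1# mod𝔪 → χ ≡ᶜ χ₁ → χ₁ ≡ᶜ χ₂ → ∀ {x} → x ∈ 𝒪ˣ →
                 (∀ k τ → x * β (Φ^ k ∙ τ) ≡ β₂ k τ mod𝔪) → k.Isomorphic ρ̄₁ ρ̄₂
    isomorphic q≡1 χ≡χ₁ χ₁≡χ₂ {x} (x∈𝒪 , y , y∈𝒪 , xy≈1) xβ≡β₂ =
      k.diag x̄ κ.1# , κⁱ.diag∈GL₂ {x̄} {y , y∈𝒪} (≈⇒≡ xy≈1) , λ g →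
      κⁱ.diag-intertwines {x̄} (ρ̄₁ g) (ρ̄₂ g) (A≡E g) (xB≡T g) (m₂₁ρ̄₁≡0 g) (m₂₁ρ̄₂≡0 g) (D≡G g)
      where
      x̄ : κ.Carrier
      x̄ = x , x∈𝒪
      A≡E : ∀ g → m₁₁ (ρ̄₁ g) κ.≈ m₁₁ (ρ̄₂ g)
      A≡E g = ≡-trans (m₁₁ρ̄₁≡χ₁ g) (≡-trans (≡-sym (χ≡χ₁ g))
        (≡-trans (≡-sym (y·ω≡y (q≡1⇒ω≡1 q≡1) g (χ∈𝒪 g))) (≡-sym (m₁₁ρ̄₂≡χω g))))
      D≡G : ∀ g → m₂₂ (ρ̄₁ g) κ.≈ m₂₂ (ρ̄₂ g)
      D≡G g = ≡-trans (m₂₂ρ̄₁≡χ₂ g) (≡-trans (≡-sym (χ₁≡χ₂ g)) (≡-trans (≡-sym (χ≡χ₁ g))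
        (≡-sym (m₂₂ρ̄₂≡χ g))))
      xB≡T : ∀ g → x̄ κ.* m₁₂ (ρ̄₁ g) κ.≈ m₁₂ (ρ̄₂ g)
      -- The congruence is given only at `Φ^ k ∙ τ`, so `g` is first brought to that form.
      xB≡T g with Φ^∙-decomposition g
      ... | k , τ , g≈Φᵏτ = ≡-trans
        (≈⇒≡ (*-congˡ (trans (ρ-cong₁₂ ρ₁ g≈Φᵏτ) (proj₁ (proj₂ (ρ₁≈ (Φ^ k ∙ τ)))))))
        (≡-trans (xβ≡β₂ k τ)
          (≈⇒≡ (sym (trans (ρ-cong₁₂ ρ₂ g≈Φᵏτ) (proj₁ (proj₂ (ρ₂≈ k τ)))))))
        where
        ρ-cong₁₂ : ∀ ρ {g h} → g W.≈ h → m₁₂ (ρ⟪ ρ ⟫ g) ≈ m₁₂ (ρ⟪ ρ ⟫ h)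
        ρ-cong₁₂ ρ {g} {h} g≈h =
          proj₁ (proj₂ (IsMonoidHomomorphism.⟦⟧-cong (Representation.isHom ρ) {g} {h} g≈h))

-- The criterion for isomorphic reductions, with both directions assembled.

theorem3p4 :
  ∀ {c e s c′ e′ s′ : Level} {p ℓ : ℕ} (S : Setting p ℓ c e s c′ e′ s′) →
  let open Setting S in
  (ρ₁ ρ₂ : Representation) (int₁ : Integral ρ₁) (int₂ : Integral ρ₂)
  (χ₁ χ₂ χ : Character) →
  IsPrincipalSeries ρ₁ χ₁ χ₂ →
  IsSpecial ρ₂ χ →
  (a₁ b₁ d₁ a₂ b₂ d₂ : Carrier) →
  mat a₁ b₁ 0# d₁ ∈ InGL₂K →
  mat a₂ b₂ 0# d₂ ∈ InGL₂K →
  let χω = λ g → χ⟪ χ ⟫ g * ω g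
      β₁ = λ g → χ⟪ χ₂ ⟫ g - χ⟪ χ₁ ⟫ g
      β₂ = λ k τ → a₂ / d₂ * tℓ τ * χω (Φ^ k ∙ τ)
                 + b₂ / d₂ * (χ⟪ χ ⟫ (Φ^ k ∙ τ) - χω (Φ^ k ∙ τ))
  in
  (∀ g → ρ⟪ ρ₁ ⟫ g ≈ᴹ mat (χ⟪ χ₁ ⟫ g) (b₁ / d₁ * β₁ g) 0# (χ⟪ χ₂ ⟫ g)) →
  (∀ k τ → ρ⟪ ρ₂ ⟫ (Φ^ k ∙ τ) ≈ᴹ mat (χω (Φ^ k ∙ τ)) (β₂ k τ) 0# (χ⟪ χ ⟫ (Φ^ k ∙ τ))) →
  a₂ / d₂ ∈ 𝒪ˣ →
  k.Isomorphic (reduction ρ₁ int₁) (reduction ρ₂ int₂)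
    ⇔
  ( + ℓ ∣ + q ℤ.- + 1
  × (χ ≡ᶜ χ₁ × χ₁ ≡ᶜ χ₂)
  × ∃[ x ] x ∈ 𝒪ˣ × (∀ τ k → b₁ * x / d₁ * β₁ (Φ^ k ∙ τ) ≡ β₂ k τ mod𝔪))
theorem3p4 S ρ₁ ρ₂ int₁ int₂ χ₁ χ₂ χ _ _ a₁ b₁ d₁ a₂ b₂ d₂ _ _ ρ₁≈ ρ₂≈ a₂/d₂∈𝒪ˣ =
  mk⇔ (λ (P , P∈GL₂ , Pρ̄₁≈ρ̄₂P) →
        let module N = Necessity P P∈GL₂ Pρ̄₁≈ρ̄₂P in
        q≡1⇒ℓ∣q-1 N.q≡1 ,
        (N.χ≡χ₁ , λ g → ≡-trans (≡-sym (N.χ≡χ₁ g)) (N.χ≡χ₂ g)) ,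
        proj₁ N.x̄ , N.x̄-unit ,
        λ τ k → ≡-trans (≈⇒≡ (scale (proj₁ N.x̄) _)) (N.x̄β≡β₂ k τ))
      (λ (ℓ∣q-1 , (χ≡χ₁ , χ₁≡χ₂) , x , x∈𝒪ˣ , β≡β₂) →
        isomorphic (ℓ∣q-1⇒q≡1 ℓ∣q-1) χ≡χ₁ χ₁≡χ₂ x∈𝒪ˣ
          (λ k τ → ≡-trans (≈⇒≡ (sym (scale x _))) (β≡β₂ τ k)))
  where
  open Setting S
  open ResidueFieldProperties K
  open SettingProperties S
  open TriangularReductions S
  open Reductions ρ₁ ρ₂ int₁ int₂ χ₁ χ₂ χ (b₁ / d₁) (a₂ / d₂) (b₂ / d₂) a₂/d₂∈𝒪ˣ ρ₁≈ ρ₂≈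
  open CommutativeSemigroupProperties *-commutativeSemigroup using (xy∙z≈y∙xz)
  scale : ∀ x y → b₁ * x / d₁ * y ≈ x * (b₁ / d₁ * y)
  scale x y = trans (*-congʳ (xy∙z≈y∙xz b₁ x (d₁ ⁻¹))) (*-assoc x (b₁ / d₁) y)
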